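{- Let $k\ge 2$ be an integer. There exists a constant $\varepsilon=\varepsilon(k)>0$ depending only on $k$ such that any algorithm for testing $k$-occurrence-freeness with proximity parameter $\varepsilon$ requires $\Omega(n^{1-1/k})$ queries, where $n$ is the length of the input sequence.
   Context: The input is a sequence $A$ of $n$ integers, each entry from $[n]=\{1,\dots,n\}$, with the promise that every value occurs in at most $k$ positions of $A$. The algorithm may query the value at any position of $A$. $A$ is $k$-occurrence-free if no value occurs in exactly $k$ positions of $A$. $A$ is $\varepsilon$-far from $k$-occurrence-free if more than $\varepsilon n$ entries of $A$ must be changed (changes may use arbitrary integers, including ones outside $[n]$) to obtain a $k$-occurrence-free sequence. A testing algorithm with parameter $\varepsilon$ must, with probability at least $2/3$, accept every $k$-occurrence-free input and reject every input that is $\varepsilon$-far from $k$-occurrence-free.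
   Formalization: A randomized testing algorithm making at most q queries is modelled as a finite probability distribution with rational (not arbitrary real) probabilities over deterministic adaptive decision trees of depth at most q. -}

module Defs where

open import Data.Nat as ℕ using (ℕ; suc; _≤_)
open import Data.Integer as ℤ using (ℤ; +_)
open import Data.Rational as ℚ using (ℚ; _/_)
open import Data.Fin using (Fin; toℕ)
open import Data.List using (List; []; _∷_; length; filter; allFin)
open import Data.Bool using (Bool; true; false)
open import Data.Product using (_×_; _,_)
open import Relation.Nullary using (¬_; ¬?)
open import Relation.Binary.PropositionalEquality using (_≡_)

⟦_⟧ : ℕ → ℚ
⟦ m ⟧ = + m / 1

-- An input sequence of length n with entries from [n] = {1,…,n};
-- Fin n is used, value v : Fin n stands for the integer toℕ v + 1.
Seq : ℕ → Set
Seq n = Fin n → Fin n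

-- a general integer sequence (changes may use arbitrary integers)
ZSeq : ℕ → Set
ZSeq n = Fin n → ℤ

embed : ∀ {n} → Seq n → ZSeq n
embed A i = + suc (toℕ (A i))

occ : ∀ {n} → ZSeq n → ℤ → ℕ
occ {n} B z = length (filter (λ i → B i ℤ.≟ z) (allFin n))

Promise : ℕ → ∀ {n} → Seq n → Set
Promise k A = ∀ z → occ (embed A) z ≤ k

KFreeZ : ℕ → ∀ {n} → ZSeq n → Set
KFreeZ k B = ∀ z → ¬ (occ B z ≡ k)

KFree : ℕ → ∀ {n} → Seq n → Set
KFree k A = KFreeZ k (embed A)

dist : ∀ {n} → Seq n → ZSeq n → ℕ
dist {n} A B = length (filter (λ i → ¬? (embed A i ℤ.≟ B i)) (allFin n))

Far : ℕ → ℚ → ∀ {n} → Seq n → Set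
Far k ε {n} A = ∀ (B : ZSeq n) → KFreeZ k B → ε ℚ.* ⟦ n ⟧ ℚ.< ⟦ dist A B ⟧

-- Deterministic adaptive query algorithm: decision tree making at most d
-- queries; each query reads a position and branches on the value read.
data DTree (n : ℕ) : ℕ → Set where
  leaf  : ∀ {d} → Bool → DTree n d
  query : ∀ {d} → Fin n → (Fin n → DTree n d) → DTree n (suc d)

run : ∀ {n d} → DTree n d → Seq n → Bool
run (leaf b) A = b
run (query i f) A = run (f (A i)) A

-- Randomized algorithm making at most q queries: a finite probability
-- distribution (rational weights) over deterministic decision trees.
weightSum : ∀ {n q} → List (ℚ × DTree n q) → ℚ
weightSum [] = ℚ.0ℚ
weightSum ((w , _) ∷ ts) = w ℚ.+ weightSum ts

acceptProb : ∀ {n q} → List (ℚ × DTree n q) → Seq n → ℚ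
acceptProb [] A = ℚ.0ℚ
acceptProb ((w , t) ∷ ts) A with run t A
... | true  = w ℚ.+ acceptProb ts A
... | false = acceptProb ts A

data AllNonNeg {n q : ℕ} : List (ℚ × DTree n q) → Set where
  []  : AllNonNeg []
  _∷_ : ∀ {w t ts} → ℚ.0ℚ ℚ.≤ w → AllNonNeg ts → AllNonNeg ((w , t) ∷ ts)

record RandAlg (n q : ℕ) : Set where
  field
    trees  : List (ℚ × DTree n q)
    nonneg : AllNonNeg trees
    total  : weightSum trees ≡ ℚ.1ℚ

open RandAlg public

IsTester : ℕ → ℚ → ∀ {n q} → RandAlg n q → Set
IsTester k ε {n} T =
  ∀ (A : Seq n) → Promise k A →
    (KFree k A → + 2 / 3 ℚ.≤ acceptProb (trees T) A) ×
    (Far k ε A → acceptProb (trees T) A ℚ.≤ + 1 / 3)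

{-# OPTIONS --safe #-}
module Submission where

-- Slots come in blocks with k coordinates: the slot (h , y , i) of block h holds the i-th coordinate of
-- y + w_h, where w_h is a secret vector in (ℤ/k)^k with coordinate sum b and y runs over all vectors with
-- coordinate sum 0. For b = 1 no y + w_h is constant, so no value occurs k times; for b = 0 the choice
-- y = − w_h makes k slots of block h share a value. The slots are put in uniformly random order. Unless all
-- k coordinates of some block are read, changing one unread coordinate of each w_h turns b = 1 into b = 0
-- unnoticed. Each query of a new position reads a uniformly random new slot, however adaptively the position
-- is chosen, so k prescribed slots are all read with probability at most q^k (n − k)! / n!; a union bound
-- over the blocks then bounds the distinguishing advantage by O(q^k / n^(k − 1)).

open import Defs
open import Data.Bool using (Bool; true; false)
import Data.Bool as Bool
open import Data.Empty using (⊥)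
open import Data.Fin using (Fin; zero; suc; toℕ; finToFun; funToFin; punchOut)
import Data.Fin as Fin
open import Data.Fin.Properties using (+↔⊎; *↔×; all?; any?; ¬∀⟶∃¬; finToFun-funToFin; injective⇒≤; punchIn-punchOut; punchOut-injective; toℕ-fromℕ<; toℕ-injective; toℕ<n)
import Data.Integer as ℤ
import Data.Integer.Properties as ℤ
open import Data.List using (List; []; _∷_; _++_; allFin; cartesianProduct; cartesianProductWith; filter; length; map)
import Data.List as List
open import Data.List.Membership.Propositional using (_∈_)
open import Data.List.Membership.Propositional.Properties using (∈-allFin; ∈-cartesianProduct⁺; ∈-cartesianProduct⁻; ∈-cartesianProductWith⁺; ∈-filter⁺; ∈-filter⁻; ∈-lookup)
open import Data.List.Properties using (filter-≐; length-++; length-map; length-tabulate; map-tabulate)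
import Data.List.Relation.Unary.All as All
open import Data.List.Relation.Unary.AllPairs using ([]; _∷_)
open import Data.List.Relation.Unary.Any using (index; here; there)
open import Data.List.Relation.Unary.Any.Properties using (lookup-index)
open import Data.List.Relation.Unary.Unique.Propositional using (Unique)
open import Data.List.Relation.Unary.Unique.Propositional.Properties using (allFin⁺; cartesianProductWith⁺; filter⁺)
import Data.Nat as ℕ
import Data.Nat.DivMod as ℕ
import Data.Nat.Properties as ℕ
import Data.Nat.Solver as ℕ
import Data.Rational as ℚ
import Data.Rational.Properties as ℚ
import Data.Rational.Solver as ℚ
open import Data.Product using (∃; _×_; _,_; proj₁; proj₂)
open import Data.Product.Function.NonDependent.Propositional using (_×-↔_)
open import Data.Sum using (_⊎_; inj₁; inj₂)
open import Data.Sum.Function.Propositional using (_⊎-↔_)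
open import Data.Vec using (Vec; []; _∷_; insertAt; lookup; tabulate; _[_]%=_)
open import Data.Vec.Properties using (insertAt-lookup; insertAt-punchIn; lookup∘tabulate; lookup∘updateAt; lookup∘updateAt′; ∷-injective)
open import Function using (Injective; Inverse; _∘_; _↔_)
open import Function.Construct.Composition using (_↔-∘_)
open import Function.Properties.Inverse using (↔-refl)
open import Relation.Binary.PropositionalEquality
open import Relation.Nullary using (Dec; yes; no; contradiction; ¬_; ¬?; _×-dec_; _⊎-dec_)
open import Relation.Unary using (Decidable)

-- An entry is not the bare coordinate: it also names h and y. Hence a value can sit in at most k
-- slots, which gives the promise for all shifts and all orders at once. Letting y run over all
-- zero-sum vectors puts a k-fold value into every block whatever w_h is, so that each single input
-- with b = 0 is far, not merely most of them.
--
-- The obstacle is adaptivity. Which coordinate is unread depends on w itself, so it is not evident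
-- that changing it preserves the uniform distribution on w. The change is injective because the
-- run, hence the set of reads, is the same before and after it: the changed coordinate can be
-- recovered from the image. This comparison fixes the order σ and varies w, whereas the bound on
-- reading k prescribed slots fixes w, which turns the algorithm into a strategy on slots, and
-- varies σ. Both are stated as counts over pairs (σ, w), so an exchange of finite sums joins them;
-- probabilities appear only with the weights of the randomized algorithm.

private variable A B C : Set

module Counting where
  open import Data.Nat
  open import Data.Nat.DivMod using (_mod_; %-distribˡ-+; %-distribˡ-*; m<n⇒m%n≡m; m%n%n≡m%n; m%n<n; [m+kn]%n≡m%n; n%n≡0)
  open import Data.Nat.Properties
  open ℕ.+-*-Solver using (solve; _:+_; _:*_; _:=_; con)

  -- Finite sums over lists

  ∑ : List A → (A → ℕ) → ℕ
  ∑ []       f = 0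
  ∑ (x ∷ xs) f = f x + ∑ xs f

  ∑-zero : ∀ (xs : List A) → ∑ xs (λ _ → 0) ≡ 0
  ∑-zero []       = refl
  ∑-zero (x ∷ xs) = ∑-zero xs

  ∑-cong : ∀ (xs : List A) {f g : A → ℕ} → (∀ x → f x ≡ g x) → ∑ xs f ≡ ∑ xs g
  ∑-cong []       eq = refl
  ∑-cong (x ∷ xs) eq = cong₂ _+_ (eq x) (∑-cong xs eq)

  ∑-mono : ∀ (xs : List A) {f g : A → ℕ} → (∀ x → f x ≤ g x) → ∑ xs f ≤ ∑ xs g
  ∑-mono []       le = z≤n
  ∑-mono (x ∷ xs) le = +-mono-≤ (le x) (∑-mono xs le)

  ∑-+ : ∀ (xs : List A) (f g : A → ℕ) → ∑ xs (λ x → f x + g x) ≡ ∑ xs f + ∑ xs g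
  ∑-+ []       f g = refl
  ∑-+ (x ∷ xs) f g rewrite ∑-+ xs f g =
    solve 4 (λ a b c d → (a :+ b) :+ (c :+ d) := (a :+ c) :+ (b :+ d)) refl (f x) (g x) (∑ xs f) (∑ xs g)

  ∑-*ˡ : ∀ (xs : List A) (c : ℕ) (f : A → ℕ) → ∑ xs (λ x → c * f x) ≡ c * ∑ xs f
  ∑-*ˡ []       c f = sym (*-zeroʳ c)
  ∑-*ˡ (x ∷ xs) c f rewrite ∑-*ˡ xs c f = sym (*-distribˡ-+ c (f x) (∑ xs f))

  ∑-*ʳ : ∀ (xs : List A) (c : ℕ) (f : A → ℕ) → ∑ xs (λ x → f x * c) ≡ ∑ xs f * c
  ∑-*ʳ xs c f = trans (∑-cong xs (λ x → *-comm (f x) c)) (trans (∑-*ˡ xs c f) (*-comm c _))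

  ∑-const : ∀ (xs : List A) (c : ℕ) → ∑ xs (λ _ → c) ≡ length xs * c
  ∑-const []       c = refl
  ∑-const (x ∷ xs) c = cong (c +_) (∑-const xs c)

  ∑-++ : ∀ (xs ys : List A) (f : A → ℕ) → ∑ (xs ++ ys) f ≡ ∑ xs f + ∑ ys f
  ∑-++ []       ys f = refl
  ∑-++ (x ∷ xs) ys f rewrite ∑-++ xs ys f = sym (+-assoc (f x) _ _)

  ∑-map : ∀ (h : B → A) (xs : List B) (f : A → ℕ) → ∑ (map h xs) f ≡ ∑ xs (f ∘ h)
  ∑-map h []       f = refl
  ∑-map h (x ∷ xs) f = cong (f (h x) +_) (∑-map h xs f)

  ∑-swap : ∀ (xs : List A) (ys : List B) (f : A → B → ℕ) →
           ∑ xs (λ x → ∑ ys (f x)) ≡ ∑ ys (λ y → ∑ xs (λ x → f x y))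
  ∑-swap []       ys f = sym (∑-zero ys)
  ∑-swap (x ∷ xs) ys f rewrite ∑-swap xs ys f = sym (∑-+ ys (f x) _)

  ∑-cartesianProductWith : ∀ (h : A → B → C) (xs : List A) (ys : List B) (f : C → ℕ) →
                           ∑ (cartesianProductWith h xs ys) f ≡ ∑ xs (λ x → ∑ ys (λ y → f (h x y)))
  ∑-cartesianProductWith h []       ys f = refl
  ∑-cartesianProductWith h (x ∷ xs) ys f =
    trans (∑-++ (map (h x) ys) _ f) (cong₂ _+_ (∑-map (h x) ys f) (∑-cartesianProductWith h xs ys f))

  indicator : ∀ {P : Set} → Dec P → ℕ
  indicator (yes _) = 1
  indicator (no _)  = 0

  ∑-indicator : ∀ {P : A → Set} (P? : Decidable P) (xs : List A) →
                ∑ xs (λ x → indicator (P? x)) ≡ length (filter P? xs)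
  ∑-indicator P? []       = refl
  ∑-indicator P? (x ∷ xs) with P? x
  ... | yes _ = cong suc (∑-indicator P? xs)
  ... | no  _ = ∑-indicator P? xs

  ∑-filter : ∀ {P : A → Set} (P? : Decidable P) (xs : List A) (f : A → ℕ) →
             ∑ (filter P? xs) f ≡ ∑ xs (λ x → indicator (P? x) * f x)
  ∑-filter P? []       f = refl
  ∑-filter P? (x ∷ xs) f with P? x
  ... | yes _ = cong₂ _+_ (sym (+-identityʳ (f x))) (∑-filter P? xs f)
  ... | no  _ = ∑-filter P? xs f

  -- Sums over all vectors

  vectors : List A → (n : ℕ) → List (Vec A n)
  vectors xs zero    = [] ∷ []
  vectors xs (suc n) = cartesianProductWith _∷_ xs (vectors xs n)

  ∑-vectors : ∀ (xs : List A) {n} (f : Vec A (suc n) → ℕ) →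
              ∑ (vectors xs (suc n)) f ≡ ∑ xs (λ x → ∑ (vectors xs n) (λ v → f (x ∷ v)))
  ∑-vectors xs {n} = ∑-cartesianProductWith _∷_ xs (vectors xs n)

  -- The entry at any position may be summed over first; this is how the slot at an adaptively
  -- chosen position is revealed before the rest of the order.
  ∑-vectors-insertAt : ∀ (xs : List A) {n} (p : Fin (suc n)) (f : Vec A (suc n) → ℕ) →
                       ∑ (vectors xs (suc n)) f ≡ ∑ xs (λ x → ∑ (vectors xs n) (λ v → f (insertAt v p x)))
  ∑-vectors-insertAt xs zero f = ∑-vectors xs f
  ∑-vectors-insertAt xs {suc n} (suc p) f = begin
    ∑ (vectors xs (2 + n)) f
      ≡⟨ ∑-vectors xs f ⟩
    ∑ xs (λ x → ∑ (vectors xs (suc n)) (λ v → f (x ∷ v)))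
      ≡⟨ ∑-cong xs (λ x → ∑-vectors-insertAt xs p (λ v → f (x ∷ v))) ⟩
    ∑ xs (λ x → ∑ xs (λ y → ∑ (vectors xs n) (λ v → f (x ∷ insertAt v p y))))
      ≡⟨ ∑-swap xs xs _ ⟩
    ∑ xs (λ y → ∑ xs (λ x → ∑ (vectors xs n) (λ v → f (x ∷ insertAt v p y))))
      ≡⟨ ∑-cong xs (λ y → ∑-vectors xs (λ v → f (insertAt v (suc p) y))) ⟨
    ∑ xs (λ y → ∑ (vectors xs (suc n)) (λ v → f (insertAt v (suc p) y))) ∎
    where open ≡-Reasoning

  -- Kronecker delta, deletion of a point, counting of permutations

  δ : ∀ {N} → Fin N → Fin N → ℕ
  δ zero    zero    = 1
  δ zero    (suc y) = 0
  δ (suc x) zero    = 0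
  δ (suc x) (suc y) = δ x y

  δ-refl : ∀ {N} (x : Fin N) → δ x x ≡ 1
  δ-refl zero    = refl
  δ-refl (suc x) = δ-refl x

  δ-≢ : ∀ {N} {x y : Fin N} → x ≢ y → δ x y ≡ 0
  δ-≢ {x = zero}  {zero}  x≢y = contradiction refl x≢y
  δ-≢ {x = zero}  {suc y} x≢y = refl
  δ-≢ {x = suc x} {zero}  x≢y = refl
  δ-≢ {x = suc x} {suc y} x≢y = δ-≢ (x≢y ∘ cong suc)

  δ-sym : ∀ {N} (x y : Fin N) → δ x y ≡ δ y x
  δ-sym zero    zero    = refl
  δ-sym zero    (suc y) = refl
  δ-sym (suc x) zero    = refl
  δ-sym (suc x) (suc y) = δ-sym x y

  δ≤1 : ∀ {N} (x y : Fin N) → δ x y ≤ 1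
  δ≤1 zero    zero    = s≤s z≤n
  δ≤1 zero    (suc y) = z≤n
  δ≤1 (suc x) zero    = z≤n
  δ≤1 (suc x) (suc y) = δ≤1 x y

  ∑-allFin-suc : ∀ {N} (f : Fin (suc N) → ℕ) → ∑ (allFin (suc N)) f ≡ f zero + ∑ (allFin N) (f ∘ suc)
  ∑-allFin-suc {N} f = cong (f zero +_)
    (trans (cong (λ l → ∑ l f) (sym (map-tabulate (λ i → i) suc))) (∑-map suc (allFin N) f))

  ∑-δ : ∀ {N} (x : Fin N) (f : Fin N → ℕ) → ∑ (allFin N) (λ y → δ x y * f y) ≡ f x
  ∑-δ {suc N} zero f = begin
    ∑ (allFin (suc N)) (λ y → δ zero y * f y) ≡⟨ ∑-allFin-suc (λ y → δ zero y * f y) ⟩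
    f zero + 0 + ∑ (allFin N) (λ _ → 0)        ≡⟨ cong₂ _+_ (+-identityʳ _) (∑-zero (allFin N)) ⟩
    f zero + 0                                 ≡⟨ +-identityʳ _ ⟩
    f zero                                     ∎
    where open ≡-Reasoning
  ∑-δ {suc N} (suc x) f = trans (∑-allFin-suc (λ y → δ (suc x) y * f y)) (∑-δ x (f ∘ suc))

  infixl 8 _∖_
  -- Sets are 0/1-valued functions. Deletion is a product, so it distributes over a splitting
  -- `b + κ` of a set, and two deletions commute by arithmetic.
  _∖_ : ∀ {N} → (Fin N → ℕ) → Fin N → (Fin N → ℕ)
  (a ∖ s) x = a x * (1 ∸ δ s x)

  ∥_∥ : ∀ {N} → (Fin N → ℕ) → ℕ
  ∥_∥ {N} a = ∑ (allFin N) a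

  ∥∖∥ : ∀ {N} (a : Fin N → ℕ) (s : Fin N) → a s + ∥ a ∖ s ∥ ≡ ∥ a ∥
  ∥∖∥ {N} a s = begin
    a s + ∥ a ∖ s ∥
      ≡⟨ cong (_+ ∥ a ∖ s ∥) (∑-δ s a) ⟨
    ∑ (allFin N) (λ x → δ s x * a x) + ∥ a ∖ s ∥
      ≡⟨ ∑-+ (allFin N) _ _ ⟨
    ∑ (allFin N) (λ x → δ s x * a x + a x * (1 ∸ δ s x))
      ≡⟨ ∑-cong (allFin N) (λ x → trans (cong (_+ a x * (1 ∸ δ s x)) (*-comm (δ s x) (a x)))
           (trans (sym (*-distribˡ-+ (a x) (δ s x) _)) (trans (cong (a x *_) (m+[n∸m]≡n (δ≤1 s x))) (*-identityʳ _)))) ⟩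
    ∥ a ∥ ∎
    where open ≡-Reasoning

  a∖s≗a : ∀ {N} (a : Fin N → ℕ) (s : Fin N) → a s ≡ 0 → ∀ x → (a ∖ s) x ≡ a x
  a∖s≗a a s as≡0 x with s Fin.≟ x
  ... | yes refl rewrite as≡0 = refl
  ... | no  s≢x  rewrite δ-≢ s≢x = *-identityʳ (a x)

  ∖-self : ∀ {N} (a : Fin N → ℕ) (s : Fin N) → (a ∖ s) s ≡ 0
  ∖-self a s rewrite δ-refl s = *-zeroʳ (a s)

  ∖≤ : ∀ {N} (a : Fin N → ℕ) (s x : Fin N) → (a ∖ s) x ≤ a x
  ∖≤ a s x = ≤-trans (*-monoʳ-≤ (a x) (m∸n≤m 1 (δ s x))) (≤-reflexive (*-identityʳ (a x)))

  -- For a 0/1-valued a, the indicator of the vectors with distinct entries, all in the support of a.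
  distinctIn : ∀ {N n} → (Fin N → ℕ) → Vec (Fin N) n → ℕ
  distinctIn a []      = 1
  distinctIn a (s ∷ σ) = a s * distinctIn (a ∖ s) σ

  distinctIn-cong : ∀ {N n} {a b : Fin N → ℕ} (σ : Vec (Fin N) n) → (∀ x → a x ≡ b x) →
                    distinctIn a σ ≡ distinctIn b σ
  distinctIn-cong []      eq = refl
  distinctIn-cong (s ∷ σ) eq = cong₂ _*_ (eq s) (distinctIn-cong σ (λ x → cong (_* (1 ∸ δ s x)) (eq x)))

  -- Deletions commute, so the entry at position p can be removed from the set before those in front
  -- of it.
  distinctIn-insertAt : ∀ {N n} (a : Fin N → ℕ) (σ : Vec (Fin N) n) (p : Fin (suc n)) (s : Fin N) →
                        distinctIn a (insertAt σ p s) ≡ a s * distinctIn (a ∖ s) σ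
  distinctIn-insertAt a σ       zero    s = refl
  distinctIn-insertAt a (t ∷ σ) (suc p) s = begin
    a t * distinctIn (a ∖ t) (insertAt σ p s)
      ≡⟨ cong (a t *_) (distinctIn-insertAt (a ∖ t) σ p s) ⟩
    a t * (a s * (1 ∸ δ t s) * distinctIn (a ∖ t ∖ s) σ)
      ≡⟨ cong₂ (λ u v → a t * (a s * (1 ∸ u) * v)) (δ-sym t s) (distinctIn-cong σ (λ x →
           solve 3 (λ u v w → u :* v :* w := u :* w :* v) refl (a x) (1 ∸ δ t x) (1 ∸ δ s x))) ⟩
    a t * (a s * (1 ∸ δ s t) * distinctIn (a ∖ s ∖ t) σ)
      ≡⟨ solve 4 (λ u v w z → u :* (v :* w :* z) := v :* (u :* w :* z)) refl (a t) (a s) (1 ∸ δ s t) _ ⟩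
    a s * (a t * (1 ∸ δ s t) * distinctIn (a ∖ s ∖ t) σ) ∎
    where open ≡-Reasoning

  ≤1-cases : ∀ {n} → n ≤ 1 → n ≡ 0 ⊎ n ≡ 1
  ≤1-cases {zero}  _ = inj₁ refl
  ≤1-cases {suc zero} _ = inj₂ refl
  ≤1-cases {suc (suc _)} (s≤s ())

  -- There are as many entries as points in the support, so the vectors counted are the orderings of
  -- the support. A first entry outside the support contributes zero; the induction hypothesis is
  -- applied where `a s` is 1.
  ∑-distinctIn : ∀ {N} n (a : Fin N → ℕ) → (∀ x → a x ≤ 1) → ∥ a ∥ ≡ n →
                 ∑ (vectors (allFin N) n) (distinctIn a) ≡ n !
  ∑-distinctIn zero a a≤1 eq = refl
  ∑-distinctIn {N} (suc n) a a≤1 eq = begin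
    ∑ (vectors (allFin N) (suc n)) (distinctIn a)
      ≡⟨ ∑-vectors (allFin N) (distinctIn a) ⟩
    ∑ (allFin N) (λ s → ∑ (vectors (allFin N) n) (λ σ → a s * distinctIn (a ∖ s) σ))
      ≡⟨ ∑-cong (allFin N) (λ s → trans (∑-*ˡ (vectors (allFin N) n) (a s) _) (step s)) ⟩
    ∑ (allFin N) (λ s → a s * n !)
      ≡⟨ ∑-*ʳ (allFin N) (n !) a ⟩
    ∥ a ∥ * n !
      ≡⟨ cong (_* n !) eq ⟩
    suc n * n ! ∎
    where
    open ≡-Reasoning
    step : ∀ s → a s * ∑ (vectors (allFin N) n) (distinctIn (a ∖ s)) ≡ a s * n !
    step s with ≤1-cases (a≤1 s)
    ... | inj₁ as≡0 rewrite as≡0 = refl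
    ... | inj₂ as≡1 = cong (a s *_) (∑-distinctIn n (a ∖ s) (λ x → ≤-trans (∖≤ a s x) (a≤1 x))
      (suc-injective (trans (cong (_+ ∥ a ∖ s ∥) (sym as≡1)) (trans (∥∖∥ a s) eq))))

  -- Chance of reading prescribed slots

  -- Strategies that read off slots; skip pads the depth when a query is answered without reading.
  data Strategy (N n : ℕ) : ℕ → Set where
    stop : ∀ {q} → Strategy N n q
    skip : ∀ {q} → Strategy N n q → Strategy N n (suc q)
    ask  : ∀ {q} → Fin n → (Fin N → Strategy N n q) → Strategy N n (suc q)

  -- What remains of a strategy once position p is known to hold s. Repeated queries of p turn into
  -- `skip`, so the depth index is unchanged; the other positions are renumbered.
  restrict : ∀ {N n q} → Fin (suc n) → Fin N → Strategy N (suc n) q → Strategy N n q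
  restrict p s stop     = stop
  restrict p s (skip t) = skip (restrict p s t)
  restrict p s (ask p′ f) with p Fin.≟ p′
  ... | yes _    = skip (restrict p s (f s))
  ... | no p≢p′ = ask (punchOut p≢p′) (λ x → restrict p s (f x))

  -- For a 0/1-valued κ: 1 if the strategy, run on σ, reads every slot in the support of κ, else 0.
  collects : ∀ {N n q} → Strategy N n q → (Fin N → ℕ) → Vec (Fin N) n → ℕ
  collects stop      κ σ = 0 ^ ∥ κ ∥
  collects (skip t)  κ σ = collects t κ σ
  collects (ask p f) κ σ = collects (f (lookup σ p)) (κ ∖ lookup σ p) σ

  collects-cong : ∀ {N n q} (t : Strategy N n q) {κ κ′ : Fin N → ℕ} (σ : Vec (Fin N) n) →
                  (∀ x → κ x ≡ κ′ x) → collects t κ σ ≡ collects t κ′ σ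
  collects-cong {N} stop  σ eq = cong (0 ^_) (∑-cong (allFin N) eq)
  collects-cong (skip t)  σ eq = collects-cong t σ eq
  collects-cong (ask p f) σ eq =
    collects-cong (f (lookup σ p)) σ (λ x → cong (_* (1 ∸ δ (lookup σ p) x)) (eq x))

  -- After `restrict`, a repeated query of p no longer deletes s. The hypothesis `κ s ≡ 0` makes
  -- that deletion without effect.
  collects-restrict : ∀ {N n q} (t : Strategy N (suc n) q) (κ : Fin N → ℕ) (p : Fin (suc n)) (s : Fin N)
                      (τ : Vec (Fin N) n) → κ s ≡ 0 →
                      collects t κ (insertAt τ p s) ≡ collects (restrict p s t) κ τ
  collects-restrict stop     κ p s τ κs≡0 = refl
  collects-restrict (skip t) κ p s τ κs≡0 = collects-restrict t κ p s τ κs≡0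
  collects-restrict (ask p′ f) κ p s τ κs≡0 with p Fin.≟ p′
  ... | yes refl rewrite insertAt-lookup τ p s =
    trans (collects-cong (f s) (insertAt τ p s) (a∖s≗a κ s κs≡0)) (collects-restrict (f s) κ p s τ κs≡0)
  ... | no p≢p′ rewrite trans (cong (lookup (insertAt τ p s)) (sym (punchIn-punchOut p≢p′))) (insertAt-punchIn τ p s (punchOut p≢p′)) =
    collects-restrict (f x) (κ ∖ x) p s τ (cong (_* (1 ∸ δ x s)) κs≡0)
    where x = lookup τ (punchOut p≢p′)

  ∥∖∥-∸ : ∀ {N} (a : Fin N → ℕ) (s : Fin N) → ∥ a ∖ s ∥ ≡ ∥ a ∥ ∸ a s
  ∥∖∥-∸ a s = trans (sym (m+n∸m≡n (a s) ∥ a ∖ s ∥)) (cong (_∸ a s) (∥∖∥ a s))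

  -- Two terms of the binomial expansion of (q + 1)^k. They match the two outcomes of one query: it
  -- hits one of the k wanted slots, or misses them all.
  bernoulli : ∀ k q → k * q ^ (k ∸ 1) + q ^ k ≤ suc q ^ k
  bernoulli zero    q = ≤-refl
  bernoulli (suc k) q = begin
    suc k * q ^ k + q * q ^ k             ≡⟨ solve 3 (λ k r q → (con 1 :+ k) :* r :+ q :* r := k :* r :+ (con 1 :+ q) :* r) refl k (q ^ k) q ⟩
    k * q ^ k + suc q * q ^ k             ≤⟨ +-monoˡ-≤ _ (shift k) ⟩
    suc q * (k * q ^ (k ∸ 1)) + suc q * q ^ k ≡⟨ *-distribˡ-+ (suc q) (k * q ^ (k ∸ 1)) (q ^ k) ⟨
    suc q * (k * q ^ (k ∸ 1) + q ^ k)     ≤⟨ *-monoʳ-≤ (suc q) (bernoulli k q) ⟩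
    suc q * suc q ^ k                     ∎
    where
    open ≤-Reasoning
    shift : ∀ k → k * q ^ k ≤ suc q * (k * q ^ (k ∸ 1))
    shift zero    = z≤n
    shift (suc k) = begin
      suc k * (q * q ^ k)     ≡⟨ solve 3 (λ a b c → a :* (b :* c) := b :* (a :* c)) refl (suc k) q (q ^ k) ⟩
      q * (suc k * q ^ k)     ≤⟨ *-monoˡ-≤ (suc k * q ^ k) (n≤1+n q) ⟩
      suc q * (suc k * q ^ k) ∎

  n*[n∸1]!≤n! : ∀ n → n * (n ∸ 1) ! ≤ n !
  n*[n∸1]!≤n! zero    = z≤n
  n*[n∸1]!≤n! (suc n) = ≤-refl

  -- κ holds the wanted slots not yet read, b the other slots not yet placed. Divided by n!, this
  -- bounds the probability of reading all of κ. Induction reveals the slot s at the queried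
  -- position: a wanted s leaves `∥ κ ∥ ∸ 1` wanted slots, any other s leaves `∥ b ∥ ∸ 1` others,
  -- and `bernoulli` adds up the two cases. Adaptivity costs nothing, as the induction hypothesis
  -- applies to each continuation `f s` separately.
  ∑-collects : ∀ {N n} q (t : Strategy N n q) (b κ : Fin N → ℕ) →
               (∀ x → b x + κ x ≤ 1) → ∥ b ∥ + ∥ κ ∥ ≡ n →
               ∑ (vectors (allFin N) n) (λ σ → distinctIn (λ x → b x + κ x) σ * collects t κ σ) ≤ q ^ ∥ κ ∥ * ∥ b ∥ !
  ∑-collects {N} {n} q stop b κ ≤1 eq = begin
    ∑ V (λ σ → distinctIn (λ x → b x + κ x) σ * 0 ^ ∥ κ ∥)
      ≡⟨ ∑-*ʳ V (0 ^ ∥ κ ∥) _ ⟩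
    ∑ V (distinctIn (λ x → b x + κ x)) * 0 ^ ∥ κ ∥
      ≡⟨ cong (_* 0 ^ ∥ κ ∥) (∑-distinctIn n _ ≤1 (trans (∑-+ (allFin N) b κ) eq)) ⟩
    n ! * 0 ^ ∥ κ ∥
      ≤⟨ final n ∥ κ ∥ eq ⟩
    q ^ ∥ κ ∥ * ∥ b ∥ ! ∎
    where
    open ≤-Reasoning
    V = vectors (allFin N) n
    -- At a stop, `0 ^ k` is 1 only if nothing is wanted any more, and then `∥ b ∥ !` orders remain.
    final : ∀ n k → ∥ b ∥ + k ≡ n → n ! * 0 ^ k ≤ q ^ k * ∥ b ∥ !
    final n zero    refl rewrite +-identityʳ ∥ b ∥ = ≤-reflexive (*-comm (∥ b ∥ !) 1)
    final n (suc k) eq   rewrite *-zeroʳ (n !) = z≤n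
  ∑-collects (suc q) (skip t) b κ ≤1 eq =
    ≤-trans (∑-collects q t b κ ≤1 eq) (*-monoˡ-≤ (∥ b ∥ !) (^-monoˡ-≤ ∥ κ ∥ (n≤1+n q)))
  ∑-collects {N} {suc n} (suc q) (ask p f) b κ ≤1 eq = begin
    ∑ (vectors (allFin N) (suc n)) (λ σ → distinctIn a σ * collects (ask p f) κ σ)
      ≡⟨ ∑-vectors-insertAt (allFin N) p _ ⟩
    ∑ (allFin N) (λ s → ∑ V (λ τ → distinctIn a (insertAt τ p s) * collects (ask p f) κ (insertAt τ p s)))
      ≡⟨ ∑-cong (allFin N) (λ s → trans (∑-cong V (unfold s)) (∑-*ˡ V (a s) _)) ⟩
    ∑ (allFin N) (λ s → a s * ∑ V (λ τ → distinctIn (λ x → (b ∖ s) x + (κ ∖ s) x) τ * collects (restrict p s (f s)) (κ ∖ s) τ))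
      ≤⟨ ∑-mono (allFin N) step ⟩
    ∑ (allFin N) (λ s → κ s * (q ^ (k ∸ 1) * β !) + b s * (q ^ k * (β ∸ 1) !))
      ≡⟨ trans (∑-+ (allFin N) _ _) (cong₂ _+_ (∑-*ʳ (allFin N) _ κ) (∑-*ʳ (allFin N) _ b)) ⟩
    k * (q ^ (k ∸ 1) * β !) + β * (q ^ k * (β ∸ 1) !)
      ≡⟨ solve 6 (λ k r f β Q g → k :* (r :* f) :+ β :* (Q :* g) := k :* r :* f :+ Q :* (β :* g)) refl
           k (q ^ (k ∸ 1)) (β !) β (q ^ k) ((β ∸ 1) !) ⟩
    k * q ^ (k ∸ 1) * β ! + q ^ k * (β * (β ∸ 1) !)
      ≤⟨ +-monoʳ-≤ (k * q ^ (k ∸ 1) * β !) (*-monoʳ-≤ (q ^ k) (n*[n∸1]!≤n! β)) ⟩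
    k * q ^ (k ∸ 1) * β ! + q ^ k * β !
      ≡⟨ *-distribʳ-+ (β !) (k * q ^ (k ∸ 1)) (q ^ k) ⟨
    (k * q ^ (k ∸ 1) + q ^ k) * β !
      ≤⟨ *-monoˡ-≤ (β !) (bernoulli k q) ⟩
    suc q ^ k * β ! ∎
    where
    open ≤-Reasoning
    V = vectors (allFin N) n
    k = ∥ κ ∥
    β = ∥ b ∥
    a : Fin N → ℕ
    a x = b x + κ x
    unfold : ∀ s τ → distinctIn a (insertAt τ p s) * collects (ask p f) κ (insertAt τ p s) ≡
             a s * (distinctIn (λ x → (b ∖ s) x + (κ ∖ s) x) τ * collects (restrict p s (f s)) (κ ∖ s) τ)
    unfold s τ rewrite insertAt-lookup τ p s | distinctIn-insertAt a τ p s
      | collects-restrict (f s) (κ ∖ s) p s τ (∖-self κ s) =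
      trans (*-assoc (a s) _ _) (cong (λ z → a s * (z * _))
        (distinctIn-cong τ (λ x → *-distribʳ-+ (1 ∸ δ s x) (b x) (κ x))))
    size : ∀ s → b s + κ s ≡ 1 → ∥ b ∖ s ∥ + ∥ κ ∖ s ∥ ≡ n
    size s e = suc-injective (trans (cong (_+ (∥ b ∖ s ∥ + ∥ κ ∖ s ∥)) (sym e))
      (trans (solve 4 (λ a b c d → (a :+ b) :+ (c :+ d) := (a :+ c) :+ (b :+ d)) refl (b s) (κ s) ∥ b ∖ s ∥ ∥ κ ∖ s ∥)
        (trans (cong₂ _+_ (∥∖∥ b s) (∥∖∥ κ s)) eq)))
    rec : ∀ s → b s + κ s ≡ 1 →
          ∑ V (λ τ → distinctIn (λ x → (b ∖ s) x + (κ ∖ s) x) τ * collects (restrict p s (f s)) (κ ∖ s) τ)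
            ≤ q ^ (k ∸ κ s) * (β ∸ b s) !
    rec s e = subst₂ (λ u v → ∑ V (λ τ → distinctIn (λ x → (b ∖ s) x + (κ ∖ s) x) τ * collects (restrict p s (f s)) (κ ∖ s) τ) ≤ q ^ u * v !)
      (∥∖∥-∸ κ s) (∥∖∥-∸ b s)
      (∑-collects q (restrict p s (f s)) (b ∖ s) (κ ∖ s)
        (λ x → ≤-trans (+-mono-≤ (∖≤ b s x) (∖≤ κ s x)) (≤1 x)) (size s e))
    step : ∀ s → a s * ∑ V (λ τ → distinctIn (λ x → (b ∖ s) x + (κ ∖ s) x) τ * collects (restrict p s (f s)) (κ ∖ s) τ) ≤
           κ s * (q ^ (k ∸ 1) * β !) + b s * (q ^ k * (β ∸ 1) !)
    step s with b s | κ s | ≤1 s | rec s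
    ... | 0     | 0     | _ | _ = z≤n
    ... | 1     | 0     | _ | r = +-monoˡ-≤ 0 (r refl)
    ... | 0     | 1     | _ | r = ≤-trans (+-monoˡ-≤ 0 (r refl)) (≤-reflexive (sym (+-identityʳ _)))
    ... | suc (suc _) | _ | s≤s () | _
    ... | suc zero | suc _ | s≤s () | _
    ... | zero | suc (suc _) | s≤s () | _

  -- Congruences modulo n

  module Mod (n : ℕ) .{{_ : NonZero n}} where

    infix 4 _~_
    infixr 5 _∙_
    -- A record, so that the two numbers stay recoverable from the type of a proof; an equation of
    -- remainders alone does not determine them.
    record _~_ (a b : ℕ) : Set where
      constructor mk
      field %≡% : a % n ≡ b % n
    open _~_ public

    ≡⇒~ : ∀ {a b} → a ≡ b → a ~ b
    ≡⇒~ refl = mk refl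

    ~-refl : ∀ {a} → a ~ a
    ~-refl = mk refl

    ~-sym : ∀ {a b} → a ~ b → b ~ a
    ~-sym (mk p) = mk (sym p)

    _∙_ : ∀ {a b c} → a ~ b → b ~ c → a ~ c
    mk p ∙ mk q = mk (trans p q)

    ~-+ : ∀ {a b c d} → a ~ b → c ~ d → a + c ~ b + d
    ~-+ {a} {b} {c} {d} (mk p) (mk q) =
      mk (trans (%-distribˡ-+ a c n) (trans (cong₂ (λ u v → (u + v) % n) p q) (sym (%-distribˡ-+ b d n))))

    ~-* : ∀ {a b c d} → a ~ b → c ~ d → a * c ~ b * d
    ~-* {a} {b} {c} {d} (mk p) (mk q) =
      mk (trans (%-distribˡ-* a c n) (trans (cong₂ (λ u v → (u * v) % n) p q) (sym (%-distribˡ-* b d n))))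

    +k*n~ : ∀ a k → a + k * n ~ a
    +k*n~ a k = mk ([m+kn]%n≡m%n a k n)

    ∑-~ : ∀ {A : Set} (xs : List A) {f g : A → ℕ} → (∀ x → f x ~ g x) → ∑ xs f ~ ∑ xs g
    ∑-~ []       h = ~-refl
    ∑-~ (x ∷ xs) h = ~-+ (h x) (∑-~ xs h)

    toℕ-mod : ∀ a → toℕ (a mod n) ≡ a % n
    toℕ-mod a = toℕ-fromℕ< (m%n<n a n)

    mod~ : ∀ a → toℕ (a mod n) ~ a
    mod~ a = mk (trans (cong (_% n) (toℕ-mod a)) (m%n%n≡m%n a n))

    mod-cong : ∀ {a b} → a ~ b → a mod n ≡ b mod n
    mod-cong {a} {b} (mk p) = toℕ-injective (trans (toℕ-mod a) (trans p (sym (toℕ-mod b))))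

    mod-toℕ : ∀ (v : Fin n) → toℕ v mod n ≡ v
    mod-toℕ v = toℕ-injective (trans (toℕ-mod (toℕ v)) (m<n⇒m%n≡m (toℕ<n v)))

    mod≡⇒~ : ∀ a {v : Fin n} → a mod n ≡ v → a ~ toℕ v
    mod≡⇒~ a refl = ~-sym (mod~ a)

  lookup-extensional : ∀ {A : Set} {n} (v v′ : Vec A n) → (∀ i → lookup v i ≡ lookup v′ i) → v ≡ v′
  lookup-extensional []      []        h = refl
  lookup-extensional (x ∷ v) (x′ ∷ v′) h = cong₂ _∷_ (h zero) (lookup-extensional v v′ (h ∘ suc))

  -- Vectors with coordinate sum 0 or 1 modulo k

  module Gadget (e : ℕ) where

    k′ k : ℕ
    k′ = suc e
    k  = suc k′

    open Mod k public

    -- Coordinate 0 is minus the sum of the others (k′ is −1 modulo k) plus b, so the coordinates sum to b modulo k.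
    coord : ℕ → (Fin k′ → Fin k) → Vec (Fin k) k′ → Fin k → Fin k
    coord b y w zero    = (b + k′ * ∑ (allFin k′) (λ j → toℕ (y j) + toℕ (lookup w j))) mod k
    coord b y w (suc j) = (toℕ (y j) + toℕ (lookup w j)) mod k

    decrement : Fin k → Fin k
    decrement v = (toℕ v + k′) mod k

    decrement-injective : ∀ {u v} → decrement u ≡ decrement v → u ≡ v
    decrement-injective {u} {v} eq = trans (increment-decrement u) (trans (cong (λ z → (toℕ z + 1) mod k) eq) (sym (increment-decrement v)))
      where
      increment-decrement : ∀ v → v ≡ (toℕ (decrement v) + 1) mod k
      increment-decrement v = trans (sym (mod-toℕ v)) (mod-cong (~-sym (~-+ (mod~ (toℕ v + k′)) ~-refl
        ∙ ≡⇒~ (solve 2 (λ v e → v :+ (con 1 :+ e) :+ con 1 := v :+ con 1 :* (con 2 :+ e)) refl (toℕ v) e)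
        ∙ +k*n~ (toℕ v) 1)))

    k′k′~1 : k′ * k′ ~ 1
    k′k′~1 = ≡⇒~ (solve 1 (λ e → (con 1 :+ e) :* (con 1 :+ e) := con 1 :+ e :* (con 2 :+ e)) refl e) ∙ +k*n~ 1 e

    k′k′*~ : ∀ c → k′ * (k′ * c) ~ c
    k′k′*~ c = ≡⇒~ (sym (*-assoc k′ k′ c)) ∙ ~-* k′k′~1 ~-refl ∙ ≡⇒~ (*-identityˡ c)

    -- Compensates for the drop of b from 1 to 0 so that only coordinate i changes. Coordinate 0 is
    -- implied rather than stored, and drops by one together with b, so for i = 0 the vector stays
    -- as it is. Decreasing a stored coordinate raises the implied one by one, which cancels that
    -- drop.
    flip : Fin k → Vec (Fin k) k′ → Vec (Fin k) k′
    flip zero    w = w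
    flip (suc j) w = w [ j ]%= decrement

    flip-injective : ∀ i {w w′} → flip i w ≡ flip i w′ → w ≡ w′
    flip-injective zero eq = eq
    flip-injective (suc j) {w} {w′} eq = lookup-extensional w w′ agree
      where
      agree : ∀ l → lookup w l ≡ lookup w′ l
      agree l with l Fin.≟ j
      ... | yes refl = decrement-injective (trans (sym (lookup∘updateAt j w)) (trans (cong (λ z → lookup z j) eq) (lookup∘updateAt j w′)))
      ... | no l≢j = trans (sym (lookup∘updateAt′ l j l≢j w)) (trans (cong (λ z → lookup z l) eq) (lookup∘updateAt′ l j l≢j w′))

    coord-flip : ∀ y w i {i′} → i ≢ i′ → coord 1 y w i′ ≡ coord 0 y (flip i w) i′
    coord-flip y w zero    {zero}   i≢i′ = contradiction refl i≢i′
    coord-flip y w zero    {suc j′} i≢i′ = refl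
    coord-flip y w (suc j) {suc j′} i≢i′ =
      cong (λ z → (toℕ (y j′) + toℕ z) mod k) (sym (lookup∘updateAt′ j′ j (i≢i′ ∘ cong suc ∘ sym) w))
    -- Decreasing coordinate j + 1 adds k′, that is -1, to the sum; multiplied by k′ this restores
    -- the 1 that b has lost.
    coord-flip y w (suc j) {zero}   i≢i′ = mod-cong (~-sym (~-* {k′} ~-refl ∑f′~ ∙ k′*[∑f+k′]~))
      where
      f f′ : Fin k′ → ℕ
      f  l = toℕ (y l) + toℕ (lookup w l)
      f′ l = toℕ (y l) + toℕ (lookup (flip (suc j) w) l)
      f′~ : ∀ l → f′ l ~ f l + δ j l * k′
      f′~ l with j Fin.≟ l
      ... | yes refl rewrite δ-refl j | lookup∘updateAt j {decrement} w =
        ~-+ {toℕ (y j)} ~-refl (mod~ (toℕ (lookup w j) + k′))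
          ∙ ≡⇒~ (solve 3 (λ y w c → y :+ (w :+ c) := y :+ w :+ (c :+ con 0)) refl (toℕ (y j)) (toℕ (lookup w j)) k′)
      ... | no j≢l rewrite δ-≢ j≢l | lookup∘updateAt′ l j {decrement} (j≢l ∘ sym) w = ≡⇒~ (sym (+-identityʳ _))
      ∑f′~ : ∑ (allFin k′) f′ ~ ∑ (allFin k′) f + k′
      ∑f′~ = ∑-~ (allFin k′) f′~
        ∙ ≡⇒~ (trans (∑-+ (allFin k′) f (λ l → δ j l * k′)) (cong (∑ (allFin k′) f +_) (∑-δ j (λ _ → k′))))
      k′*[∑f+k′]~ : k′ * (∑ (allFin k′) f + k′) ~ 1 + k′ * ∑ (allFin k′) f
      k′*[∑f+k′]~ = ≡⇒~ (trans (*-distribˡ-+ k′ (∑ (allFin k′) f) k′) (+-comm (k′ * ∑ (allFin k′) f) (k′ * k′)))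
        ∙ ~-+ k′k′~1 ~-refl

    -- Adding `k′ * c` to both sides would give 1 ~ 0, which k ≥ 2 excludes.
    1+c≁c : ∀ c → ¬ (1 + c ~ c)
    1+c≁c c eq with ~-sym (≡⇒~ (cong suc (*-comm k c)) ∙ +k*n~ 1 c) ∙ ~-+ {c = k′ * c} eq ~-refl ∙ ≡⇒~ (*-comm k c) ∙ +k*n~ 0 c
    ... | mk p = contradiction (trans (sym (m<n⇒m%n≡m {n = k} (s≤s (s≤s z≤n)))) p) λ ()

    -- A constant vector has coordinate sum k * c, which is 0 and not 1 modulo k. In terms of
    -- coordinate 0: it would be congruent both to c and to 1 + c.
    coord₁-nonconstant : ∀ y w v → ¬ (∀ i → coord 1 y w i ≡ v)
    coord₁-nonconstant y w v const = 1+c≁c c (~-+ {1} ~-refl (~-sym (k′k′*~ c) ∙ ~-* {k′} ~-refl (~-sym ∑~)) ∙ mod≡⇒~ _ (const zero))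
      where
      c = toℕ v
      ∑~ : ∑ (allFin k′) (λ j → toℕ (y j) + toℕ (lookup w j)) ~ k′ * c
      ∑~ = ∑-~ (allFin k′) (λ j → mod≡⇒~ _ (const (suc j))) ∙ ≡⇒~ (trans (∑-const (allFin k′) c) (cong (_* c) (length-tabulate {n = k′} (λ i → i))))

    opposite : Vec (Fin k) k′ → Fin k′ → Fin k
    opposite w j = (k ∸ toℕ (lookup w j)) mod k

    -- The hypothesis on y is pointwise, since a function decoded from its code in `Fin (k ^ k′)` is
    -- known to agree with the original only pointwise.
    coord₀-opposite : ∀ y w → (∀ j → y j ≡ opposite w j) → ∀ i → coord 0 y w i ≡ zero
    coord₀-opposite y w y≗ = go
      where
      cancel : ∀ j → toℕ (y j) + toℕ (lookup w j) ~ 0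
      cancel j = ~-+ (≡⇒~ (cong toℕ (y≗ j)) ∙ mod~ (k ∸ toℕ (lookup w j))) ~-refl
        ∙ ≡⇒~ (m∸n+n≡m (<⇒≤ (toℕ<n (lookup w j)))) ∙ mk (n%n≡0 k)
      go : ∀ i → coord 0 y w i ≡ zero
      go (suc j) = mod-cong {b = 0} (cancel j)
      go zero    = mod-cong {b = 0} (~-* {k′} ~-refl (∑-~ (allFin k′) cancel)
        ∙ ≡⇒~ (trans (cong (k′ *_) (∑-zero (allFin k′))) (*-zeroʳ k′)))

  -- Pigeonhole principles

  lookup-injective : ∀ {xs : List A} → Unique xs → ∀ {i j} → List.lookup xs i ≡ List.lookup xs j → i ≡ j
  lookup-injective (px ∷ u) {zero}  {zero}  eq = refl
  lookup-injective (px ∷ u) {zero}  {suc j} eq = contradiction eq (All.lookup px (∈-lookup j))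
  lookup-injective (px ∷ u) {suc i} {zero}  eq = contradiction (sym eq) (All.lookup px (∈-lookup i))
  lookup-injective (px ∷ u) {suc i} {suc j} eq = cong suc (lookup-injective u eq)

  -- Pigeonhole principle. Injectivity is asked for on members of xs only: the coupling of shifts is
  -- injective just on the unexposed ones.
  length-≤ : ∀ {xs : List A} {ys : List B} → Unique xs → (φ : A → B) →
             (∀ {x} → x ∈ xs → φ x ∈ ys) →
             (∀ {x y} → x ∈ xs → y ∈ xs → φ x ≡ φ y → x ≡ y) → length xs ≤ length ys
  length-≤ {xs = xs} {ys} u φ mem inj = injective⇒≤ {f = λ i → index (mem (∈-lookup {xs = xs} i))} λ {i} {j} eq →
    lookup-injective u (inj (∈-lookup i) (∈-lookup j)
      (trans (lookup-index (mem (∈-lookup {xs = xs} i)))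
        (trans (cong (List.lookup ys) eq) (sym (lookup-index (mem (∈-lookup {xs = xs} j)))))))

  -- If v were missed, punching it out of the codomain would leave an injection into a set with
  -- fewer than M elements.
  injective⇒surjective : ∀ {M N} {f : Fin M → Fin N} → Injective _≡_ _≡_ f → N ≤ M → ∀ v → ∃ λ i → f i ≡ v
  injective⇒surjective {M} {suc N} {f} inj N≤M v with any? (λ i → f i Fin.≟ v)
  ... | yes p = p
  ... | no ∄ = contradiction (≤-trans N≤M (injective⇒≤ {f = λ i → punchOut (v≢ i)}
          (λ {i} {j} eq → inj (punchOut-injective (v≢ i) (v≢ j) eq)))) 1+n≰n
    where
    v≢ : ∀ i → v ≢ f i
    v≢ i eq = ∄ (i , sym eq)

  length-allFin : ∀ n → length (allFin n) ≡ n
  length-allFin n = length-tabulate {n = n} (λ i → i)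

  length-cartesianProductWith : ∀ (f : A → B → C) xs ys → length (cartesianProductWith f xs ys) ≡ length xs * length ys
  length-cartesianProductWith f []       ys = refl
  length-cartesianProductWith f (x ∷ xs) ys = trans (length-++ (map (f x) ys))
    (cong₂ _+_ (length-map (f x) ys) (length-cartesianProductWith f xs ys))

  -- The two families of inputs

  module Inputs (e n m r : ℕ) where
    open Gadget e public

    -- The r fillers absorb the remainder of n modulo the block size, so that lengths n of every
    -- residue are covered.
    Slot : Set
    Slot = (Fin m × Fin (k ^ k′) × Fin k) ⊎ Fin r

    -- The value held by a slot is itself named by a slot, which keeps values within [n].
    relabel : ℕ → Vec (Vec (Fin k) k′) m → Slot → Slot
    relabel b w (inj₁ (h , y , i)) = inj₁ (h , y , coord b (finToFun y) (lookup w h) i)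
    relabel b w (inj₂ x)           = inj₂ x

    position : Slot → Fin k
    position (inj₁ (_ , _ , i)) = i
    -- Default for fillers; `input₁-kfree` relies on its being different from coordinate 1.
    position (inj₂ _)           = zero

    -- The value retains h and y, so only the index of the coordinate is lost. Hence at most k slots
    -- share a value.
    relabel-position-injective : ∀ b w s s′ → relabel b w s ≡ relabel b w s′ → position s ≡ position s′ → s ≡ s′
    relabel-position-injective b w (inj₁ (h , y , i)) (inj₁ (h′ , y′ , i′)) eq refl =
      cong (λ { (inj₁ (h , y , _)) → inj₁ (h , y , i) ; (inj₂ x) → inj₂ x }) eq
    relabel-position-injective b w (inj₂ x) (inj₂ x) refl _ = refl

    module Layout (layout : Fin n ↔ Slot) where
      open Inverse layout using () renaming (to to slotOf; from to codeOf; strictlyInverseˡ to slotOf-codeOf; strictlyInverseʳ to codeOf-slotOf) public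

      slotOf-injective : ∀ {x y} → slotOf x ≡ slotOf y → x ≡ y
      slotOf-injective {x} {y} eq = trans (sym (codeOf-slotOf x)) (trans (cong codeOf eq) (codeOf-slotOf y))

      codeOf-injective : ∀ {x y} → codeOf x ≡ codeOf y → x ≡ y
      codeOf-injective {x} {y} eq = trans (sym (slotOf-codeOf x)) (trans (cong slotOf eq) (slotOf-codeOf y))

      value : ℕ → Vec (Vec (Fin k) k′) m → Fin n → Fin n
      value b w s = codeOf (relabel b w (slotOf s))

      input : ℕ → Vec (Vec (Fin k) k′) m → Vec (Fin n) n → Seq n
      input b w σ p = value b w (lookup σ p)

      module _ (w : Vec (Vec (Fin k) k′) m) (σ : Vec (Fin n) n)
               (σ-injective : Injective _≡_ _≡_ (lookup σ)) where

        occurrences : ZSeq n → ℤ.ℤ → List (Fin n)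
        occurrences B z = filter (λ i → B i ℤ.≟ z) (allFin n)

        occurrences-unique : ∀ B z → Unique (occurrences B z)
        occurrences-unique B z = filter⁺ (λ i → B i ℤ.≟ z) (allFin⁺ n)

        ∈-occurrences : ∀ B z {p} → p ∈ occurrences B z → B p ≡ z
        ∈-occurrences B z p∈ = proj₂ (∈-filter⁻ (λ i → B i ℤ.≟ z) {xs = allFin n} p∈)

        coordinate : Fin n → Fin k
        coordinate p = position (slotOf (lookup σ p))

        embed⇒relabel : ∀ b {z p p′} → embed (input b w σ) p ≡ z → embed (input b w σ) p′ ≡ z →
                        relabel b w (slotOf (lookup σ p)) ≡ relabel b w (slotOf (lookup σ p′))
        embed⇒relabel b e₁ e₂ = codeOf-injective (toℕ-injective (suc-injective (ℤ.+-injective (trans e₁ (sym e₂)))))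

        coordinate-injective : ∀ b {z p p′} → embed (input b w σ) p ≡ z → embed (input b w σ) p′ ≡ z →
                               coordinate p ≡ coordinate p′ → p ≡ p′
        coordinate-injective b e₁ e₂ eq = σ-injective (slotOf-injective
          (relabel-position-injective b w _ _ (embed⇒relabel b e₁ e₂) eq))

        input-promise : ∀ b → Promise k (input b w σ)
        input-promise b z = subst (occ (embed (input b w σ)) z ≤_) (length-allFin k)
          (length-≤ (occurrences-unique _ z) coordinate (λ _ → ∈-allFin _)
            (λ p∈ p′∈ → coordinate-injective b (∈-occurrences _ z p∈) (∈-occurrences _ z p′∈)))

        -- The k occurrences of a value have distinct coordinate indices, hence all k of them, at a
        -- common h and y. Their common value would make y + w_h constant.
        input₁-kfree : KFree k (input 1 w σ)
        input₁-kfree z occ≡k = go (slotOf (lookup σ (proj₁ (hit zero)))) refl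
          where
          xs = occurrences (embed (input 1 w σ)) z
          hit : ∀ i → ∃ λ p → embed (input 1 w σ) p ≡ z × coordinate p ≡ i
          hit i with injective⇒surjective {f = λ l → coordinate (List.lookup xs l)}
            (λ {l} {l′} eq → lookup-injective (occurrences-unique _ z)
              (coordinate-injective 1 (∈-occurrences _ z (∈-lookup l)) (∈-occurrences _ z (∈-lookup l′)) eq))
            (≤-reflexive (sym occ≡k)) i
          ... | l , eq = List.lookup xs l , ∈-occurrences _ z (∈-lookup l) , eq
          same : ∀ i → relabel 1 w (slotOf (lookup σ (proj₁ (hit zero)))) ≡ relabel 1 w (slotOf (lookup σ (proj₁ (hit i))))
          same i = embed⇒relabel 1 (proj₁ (proj₂ (hit zero))) (proj₁ (proj₂ (hit i)))
          go : ∀ s → slotOf (lookup σ (proj₁ (hit zero))) ≡ s → _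
          -- The value of a filler would have to occur at a slot with coordinate index 1 as well,
          -- but fillers have index 0.
          go (inj₂ x) eq = rest (slotOf (lookup σ (proj₁ (hit (suc zero)))))
            (trans (sym (cong (relabel 1 w) eq)) (same (suc zero))) (proj₂ (proj₂ (hit (suc zero))))
            where
            rest : ∀ s → inj₂ x ≡ relabel 1 w s → ¬ (position s ≡ suc zero)
            rest (inj₂ _) _ ()
          go (inj₁ (h , y , i₀)) eq = coord₁-nonconstant (finToFun y) (lookup w h) v (λ i →
            cell i (slotOf (lookup σ (proj₁ (hit i)))) (trans (sym (cong (relabel 1 w) eq)) (same i)) (proj₂ (proj₂ (hit i))))
            where
            v = coord 1 (finToFun y) (lookup w h) i₀
            cell : ∀ i s → inj₁ (h , y , v) ≡ relabel 1 w s → position s ≡ i → coord 1 (finToFun y) (lookup w h) i ≡ v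
            cell i (inj₁ (h′ , y′ , .i)) eq refl = sym (proj-cell {v′ = i} eq)
              where
              proj-cell : ∀ {h y v h′ y′ v′} → _≡_ {A = Slot} (inj₁ (h , y , v)) (inj₁ (h′ , y′ , coord 1 (finToFun y′) (lookup w h′) v′)) →
                          v ≡ coord 1 (finToFun y) (lookup w h) v′
              proj-cell refl = refl

        module _ (B : ZSeq n) (B-free : KFreeZ k B) where

          A₀ : ZSeq n
          A₀ = embed (input 0 w σ)

          heavyValue : Fin m → ℤ.ℤ
          heavyValue h = ℤ.+ suc (toℕ (codeOf (inj₁ (h , funToFin (opposite (lookup w h)) , zero))))

          heavyValue-injective : ∀ {h h′} → heavyValue h ≡ heavyValue h′ → h ≡ h′
          heavyValue-injective eq = inj (codeOf-injective (toℕ-injective (suc-injective (ℤ.+-injective eq))))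
            where
            inj : ∀ {h h′ y y′ i i′} → _≡_ {A = Slot} (inj₁ (h , y , i)) (inj₁ (h′ , y′ , i′)) → h ≡ h′
            inj refl = refl

          heavyValue-occ : ∀ h → occ A₀ (heavyValue h) ≡ k
          heavyValue-occ h = ≤-antisym (input-promise 0 (heavyValue h))
            (subst (_≤ occ A₀ (heavyValue h)) (length-allFin k)
              (length-≤ (allFin⁺ k) (λ i → proj₁ (at i)) (λ {i} _ → ∈-filter⁺ _ (∈-allFin _) (heavy i))
                (λ {i} {j} _ _ eq → cell-injective (codeOf-injective
                  (trans (sym (proj₂ (at i))) (trans (cong (lookup σ) eq) (proj₂ (at j))))))))
            where
            y = funToFin (opposite (lookup w h))
            at : ∀ i → ∃ λ p → lookup σ p ≡ codeOf (inj₁ (h , y , i))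
            at i = injective⇒surjective σ-injective ≤-refl (codeOf (inj₁ (h , y , i)))
            cell-injective : ∀ {i j} → _≡_ {A = Slot} (inj₁ (h , y , i)) (inj₁ (h , y , j)) → i ≡ j
            cell-injective refl = refl
            heavy : ∀ i → A₀ (proj₁ (at i)) ≡ heavyValue h
            heavy i = cong (λ s → ℤ.+ suc (toℕ (codeOf s)))
              (trans (cong (λ p → relabel 0 w (slotOf p)) (proj₂ (at i)))
              (trans (cong (relabel 0 w) (slotOf-codeOf _))
                (cong (λ v → inj₁ (h , y , v)) (coord₀-opposite (finToFun y) (lookup w h) (finToFun-funToFin _) i))))

          select : Bool → Fin n → ℤ.ℤ
          select true  p = A₀ p
          select false p = B p

          -- Otherwise A₀ and B would carry `heavyValue h` at the same positions, hence k times in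
          -- B. The flag tells which of the two sequences has the value at p, so p and the flag
          -- together determine h.
          disagreement : ∀ h → ∃ λ p → ∃ λ side → A₀ p ≢ B p × select side p ≡ heavyValue h
          disagreement h with any? (λ p → (A₀ p ℤ.≟ z) ×-dec ¬? (B p ℤ.≟ z)) | any? (λ p → (B p ℤ.≟ z) ×-dec ¬? (A₀ p ℤ.≟ z))
            where z = heavyValue h
          ... | yes (p , Ap≡z , Bp≢z) | _ = p , true  , (λ eq → Bp≢z (trans (sym eq) Ap≡z)) , Ap≡z
          ... | no _ | yes (p , Bp≡z , Ap≢z) = p , false , (λ eq → Ap≢z (trans eq Bp≡z)) , Bp≡z
          ... | no ∄₁ | no ∄₂ = contradiction (trans (cong length (sym
                  (filter-≐ (λ i → A₀ i ℤ.≟ z) (λ i → B i ℤ.≟ z) (A⊆B , B⊆A) (allFin n)))) (heavyValue-occ h)) (B-free z)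
            where
            z = heavyValue h
            A⊆B : ∀ {i} → A₀ i ≡ z → B i ≡ z
            A⊆B {i} eq with B i ℤ.≟ z
            ... | yes q = q
            ... | no ¬q = contradiction (i , eq , ¬q) ∄₁
            B⊆A : ∀ {i} → B i ≡ z → A₀ i ≡ z
            B⊆A {i} eq with A₀ i ℤ.≟ z
            ... | yes q = q
            ... | no ¬q = contradiction (i , eq , ¬q) ∄₂

          -- One changed entry can destroy one heavy value and complete another, hence the factor 2.
          input₀-far : m ≤ dist (input 0 w σ) B * 2
          input₀-far = subst₂ _≤_ (length-allFin m) (length-cartesianProductWith _,_ changed (true ∷ false ∷ []))
            (length-≤ (allFin⁺ m) (λ h → proj₁ (disagreement h) , proj₁ (proj₂ (disagreement h)))
              (λ {h} _ → ∈-cartesianProduct⁺ (∈-filter⁺ _ (∈-allFin _) (proj₁ (proj₂ (proj₂ (disagreement h))))) (∈-Bool _))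
              (λ {h} {h′} _ _ eq → heavyValue-injective (trans (sym (proj₂ (proj₂ (proj₂ (disagreement h)))))
                (trans (cong (λ { (p , side) → select side p }) eq) (proj₂ (proj₂ (proj₂ (disagreement h′))))))))
            where
            changed = filter (λ i → ¬? (A₀ i ℤ.≟ B i)) (allFin n)
            ∈-Bool : ∀ side → side ∈ true ∷ false ∷ []
            ∈-Bool true  = here refl
            ∈-Bool false = there (here refl)

  -- Supports, lists of all vectors, first failures

  ∈⇒≤∑ : ∀ {xs : List A} {x} (f : A → ℕ) → x ∈ xs → f x ≤ ∑ xs f
  ∈⇒≤∑ f (here refl) = m≤m+n _ _
  ∈⇒≤∑ f (there x∈)  = ≤-trans (∈⇒≤∑ f x∈) (m≤n+m _ _)

  ∑≢0⇒∃ : ∀ (xs : List A) (f : A → ℕ) → ∑ xs f ≢ 0 → ∃ λ x → f x ≢ 0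
  ∑≢0⇒∃ []       f ≢0 = contradiction refl ≢0
  ∑≢0⇒∃ (x ∷ xs) f ≢0 with f x ≟ 0
  ... | no  fx≢0 = x , fx≢0
  ... | yes fx≡0 = ∑≢0⇒∃ xs f (λ eq → ≢0 (cong₂ _+_ fx≡0 eq))

  δ≢0⇒≡ : ∀ {N} {x y : Fin N} → δ x y ≢ 0 → x ≡ y
  δ≢0⇒≡ {x = x} {y} δ≢0 with x Fin.≟ y
  ... | yes eq = eq
  ... | no neq = contradiction (δ-≢ neq) δ≢0

  ∑-δ-injective≤1 : ∀ {K N} {g : Fin K → Fin N} → Injective _≡_ _≡_ g → ∀ x → ∑ (allFin K) (λ i → δ (g i) x) ≤ 1
  ∑-δ-injective≤1 {K} {g = g} inj x with any? (λ i → g i Fin.≟ x)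
  ... | no ∄ = ≤-trans (≤-reflexive (trans (∑-cong (allFin K) (λ i → δ-≢ (λ eq → ∄ (i , eq)))) (∑-zero (allFin K)))) z≤n
  ... | yes (i₀ , refl) = ≤-reflexive (trans (∑-cong (allFin K) pointwise) (∑-δ i₀ (λ _ → 1)))
    where
    pointwise : ∀ i → δ (g i) (g i₀) ≡ δ i₀ i * 1
    pointwise i with i₀ Fin.≟ i
    ... | yes refl = trans (δ-refl (g i)) (sym (cong (_* 1) (δ-refl i)))
    ... | no i₀≢i = trans (δ-≢ (i₀≢i ∘ sym ∘ inj)) (sym (cong (_* 1) (δ-≢ i₀≢i)))

  *≢0ˡ : ∀ {m n} → m * n ≢ 0 → m ≢ 0
  *≢0ˡ mn≢0 refl = mn≢0 refl

  *≢0ʳ : ∀ {m n} → m * n ≢ 0 → n ≢ 0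
  *≢0ʳ {m} mn≢0 refl = mn≢0 (*-zeroʳ m)

  distinctIn≤1 : ∀ {N n} (a : Fin N → ℕ) → (∀ x → a x ≤ 1) → (σ : Vec (Fin N) n) → distinctIn a σ ≤ 1
  distinctIn≤1 a a≤1 []      = ≤-refl
  distinctIn≤1 a a≤1 (s ∷ σ) = *-mono-≤ (a≤1 s) (distinctIn≤1 (a ∖ s) (λ x → ≤-trans (∖≤ a s x) (a≤1 x)) σ)

  distinctIn-support : ∀ {N n} (a : Fin N → ℕ) (σ : Vec (Fin N) n) → distinctIn a σ ≢ 0 → ∀ i → a (lookup σ i) ≢ 0
  distinctIn-support a (s ∷ σ) ≢0 zero    = *≢0ˡ ≢0
  distinctIn-support a (s ∷ σ) ≢0 (suc i) = *≢0ˡ (distinctIn-support (a ∖ s) σ (*≢0ʳ {a s} ≢0) i)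

  distinctIn-injective : ∀ {N n} (a : Fin N → ℕ) (σ : Vec (Fin N) n) → distinctIn a σ ≢ 0 → Injective _≡_ _≡_ (lookup σ)
  distinctIn-injective a (s ∷ σ) ≢0 {zero}  {zero}  eq = refl
  distinctIn-injective a (s ∷ σ) ≢0 {zero}  {suc j} refl =
    contradiction (∖-self a (lookup σ j)) (distinctIn-support (a ∖ s) σ (*≢0ʳ {a s} ≢0) j)
  distinctIn-injective a (s ∷ σ) ≢0 {suc i} {zero}  refl =
    contradiction (∖-self a (lookup σ i)) (distinctIn-support (a ∖ s) σ (*≢0ʳ {a s} ≢0) i)
  distinctIn-injective a (s ∷ σ) ≢0 {suc i} {suc j} eq = cong suc (distinctIn-injective (a ∖ s) σ (*≢0ʳ {a s} ≢0) eq)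

  vectors-unique : ∀ {xs : List A} → Unique xs → ∀ n → Unique (vectors xs n)
  vectors-unique u zero    = All.[] ∷ []
  vectors-unique u (suc n) = cartesianProductWith⁺ _∷_ ∷-injective u (vectors-unique u n)

  ∈-vectors : ∀ {xs : List A} → (∀ x → x ∈ xs) → ∀ {n} (v : Vec A n) → v ∈ vectors xs n
  ∈-vectors all∈ []      = here refl
  ∈-vectors all∈ (x ∷ v) = ∈-cartesianProductWith⁺ _∷_ (all∈ x) (∈-vectors all∈ v)

  length-vectors : ∀ (xs : List A) n → length (vectors xs n) ≡ length xs ^ n
  length-vectors xs zero    = refl
  length-vectors xs (suc n) = trans (length-cartesianProductWith _∷_ xs (vectors xs n)) (cong (length xs *_) (length-vectors xs n))

  -- Total, with the last index as untested default. The choice depends only on which indices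
  -- satisfy P, which lets the coupling recover it from the reads.
  firstFailure : ∀ {n} {P : Fin (suc n) → Set} → Decidable P → Fin (suc n)
  firstFailure {zero}  P? = zero
  firstFailure {suc n} P? with P? zero
  ... | no  _ = zero
  ... | yes _ = suc (firstFailure (P? ∘ suc))

  firstFailure-fails : ∀ {n} {P : Fin (suc n) → Set} (P? : Decidable P) → (∃ λ i → ¬ P i) → ¬ P (firstFailure P?)
  firstFailure-fails {zero}  P? (zero , ¬Pi) = ¬Pi
  firstFailure-fails {suc n} P? (i , ¬Pi) with P? zero | i
  ... | no ¬P0 | _     = ¬P0
  ... | yes P0 | zero  = contradiction P0 ¬Pi
  ... | yes P0 | suc j = firstFailure-fails (P? ∘ suc) (j , ¬Pi)

  firstFailure-cong : ∀ {n} {P Q : Fin (suc n) → Set} (P? : Decidable P) (Q? : Decidable Q) →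
                      (∀ {i} → P i → Q i) → (∀ {i} → Q i → P i) → firstFailure P? ≡ firstFailure Q?
  firstFailure-cong {zero}  P? Q? P⇒Q Q⇒P = refl
  firstFailure-cong {suc n} P? Q? P⇒Q Q⇒P with P? zero | Q? zero
  ... | no _  | no _   = refl
  ... | no ¬p | yes q  = contradiction (Q⇒P q) ¬p
  ... | yes p | no ¬q  = contradiction (P⇒Q p) ¬q
  ... | yes _ | yes _  = cong suc (firstFailure-cong (P? ∘ suc) (Q? ∘ suc) P⇒Q Q⇒P)

  -- Runs of decision trees

  Queried : ∀ {n q} → DTree n q → Seq n → Fin n → Set
  Queried (leaf _)    A p = ⊥
  Queried (query i f) A p = i ≡ p ⊎ Queried (f (A i)) A p

  queried? : ∀ {n q} (t : DTree n q) (A : Seq n) → Decidable (Queried t A)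
  queried? (leaf _)    A p = no λ ()
  queried? (query i f) A p = (i Fin.≟ p) ⊎-dec queried? (f (A i)) A p

  -- Agreement along the run on A suffices: equal answers keep both runs on the same branch. The
  -- two-way transfer of queried positions is what makes the coupling invertible.
  run-local : ∀ {n q} (t : DTree n q) (A A′ : Seq n) → (∀ p → Queried t A p → A p ≡ A′ p) →
              run t A ≡ run t A′ × (∀ p → Queried t A p → Queried t A′ p) × (∀ p → Queried t A′ p → Queried t A p)
  run-local (leaf _)    A A′ agree = refl , (λ p q → q) , (λ p q → q)
  run-local (query i f) A A′ agree with A i | A′ i | agree i (inj₁ refl) | (λ p q → agree p (inj₂ q))
  ... | x | .x | refl | agree′ with run-local (f x) A A′ agree′
  ... | r , to , from = r , (λ { p (inj₁ eq) → inj₁ eq ; p (inj₂ q) → inj₂ (to p q) })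
                          , (λ { p (inj₁ eq) → inj₁ eq ; p (inj₂ q) → inj₂ (from p q) })

  accepts : ∀ {n q} → DTree n q → Seq n → ℕ
  accepts t A = indicator (run t A Bool.≟ true)

  -- Coupling of the two families

  module Coupling (e n m r : ℕ) (layout : Fin n ↔ Inputs.Slot e n m r) where
    open Inputs e n m r
    open Layout layout

    Shifts : Set
    Shifts = Vec (Vec (Fin k) k′) m

    shifts : List Shifts
    shifts = vectors (vectors (allFin k) k′) m

    cellIn? : ∀ h i (s : Slot) → Dec (∃ λ y → s ≡ inj₁ (h , y , i))
    cellIn? h i (inj₂ x) = no λ ()
    cellIn? h i (inj₁ (h′ , y , i′)) with h′ Fin.≟ h | i′ Fin.≟ i
    ... | yes refl | yes refl = yes (y , refl)
    ... | no neq   | _        = no λ { (_ , refl) → neq refl }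
    ... | yes _    | no neq   = no λ { (_ , refl) → neq refl }

    module _ {q} (t : DTree n q) (σ : Vec (Fin n) n) where

      Reads : Seq n → Fin m → Fin k → Set
      Reads A h i = ∃ λ p → Queried t A p × ∃ λ y → slotOf (lookup σ p) ≡ inj₁ (h , y , i)

      reads? : ∀ A h → Decidable (Reads A h)
      reads? A h i = any? (λ p → queried? t A p ×-dec cellIn? h i (slotOf (lookup σ p)))

      Exposed : Shifts → Set
      Exposed w = ∃ λ h → ∀ i → Reads (input 1 w σ) h i

      exposed? : Decidable Exposed
      exposed? w = any? (λ h → all? (reads? (input 1 w σ) h))

      hidden : ∀ {w} → ¬ Exposed w → ∀ h → ∃ λ i → ¬ Reads (input 1 w σ) h i
      hidden ¬ex h = ¬∀⟶∃¬ _ _ (reads? _ h) (λ all → ¬ex (h , all))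

      unread : Shifts → Fin m → Fin k
      unread w h = firstFailure (reads? (input 1 w σ) h)

      couple : Shifts → Shifts
      couple w = tabulate (λ h → flip (unread w h) (lookup w h))

      couple-agrees : ∀ {w} → ¬ Exposed w → ∀ p → Queried t (input 1 w σ) p → input 1 w σ p ≡ input 0 (couple w) σ p
      couple-agrees {w} ¬ex p queried = cong codeOf (go (slotOf (lookup σ p)) refl)
        where
        go : ∀ s → slotOf (lookup σ p) ≡ s → relabel 1 w s ≡ relabel 0 (couple w) s
        go (inj₂ x) _ = refl
        go (inj₁ (h , y , i)) eq = cong (λ v → inj₁ (h , y , v)) (trans
          (coord-flip (finToFun y) (lookup w h) (unread w h) λ u≡i →
            firstFailure-fails (reads? (input 1 w σ) h) (hidden ¬ex h) (subst (Reads (input 1 w σ) h) (sym u≡i) (p , queried , y , eq)))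
          (cong (λ v → coord 0 (finToFun y) v i) (sym (lookup∘tabulate (λ h → flip (unread w h) (lookup w h)) h))))

      couple-local : ∀ {w} → ¬ Exposed w → run t (input 1 w σ) ≡ run t (input 0 (couple w) σ) ×
                     (∀ p → Queried t (input 1 w σ) p → Queried t (input 0 (couple w) σ) p) ×
                     (∀ p → Queried t (input 0 (couple w) σ) p → Queried t (input 1 w σ) p)
      couple-local ¬ex = run-local t _ _ (couple-agrees ¬ex)

      -- Each run with b = 1 queries the same positions as the coupled run with b = 0. Equal images
      -- thus force equal reads, hence the same unread coordinate in every block, and flipping at a
      -- known coordinate is injective.
      couple-injective : ∀ {w w′} → ¬ Exposed w → ¬ Exposed w′ → couple w ≡ couple w′ → w ≡ w′
      couple-injective {w} {w′} ¬ex ¬ex′ eq = lookup-extensional w w′ λ h → flip-injective (unread w h)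
        (trans (sym (lookup∘tabulate (λ h → flip (unread w h) (lookup w h)) h))
        (trans (cong (λ v → lookup v h) eq)
        (trans (lookup∘tabulate (λ h → flip (unread w′ h) (lookup w′ h)) h)
        (cong (λ i → flip i (lookup w′ h)) (sym (unread-≡ h))))))
        where
        transfer : ∀ {h i} → Reads (input 1 w σ) h i → Reads (input 1 w′ σ) h i
        transfer (p , queried , cell) = p , proj₂ (proj₂ (couple-local ¬ex′)) p
          (subst (λ v → Queried t (input 0 v σ) p) eq (proj₁ (proj₂ (couple-local ¬ex)) p queried)) , cell
        transfer⁻ : ∀ {h i} → Reads (input 1 w′ σ) h i → Reads (input 1 w σ) h i
        transfer⁻ (p , queried , cell) = p , proj₂ (proj₂ (couple-local ¬ex)) p
          (subst (λ v → Queried t (input 0 v σ) p) (sym eq) (proj₁ (proj₂ (couple-local ¬ex′)) p queried)) , cell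
        unread-≡ : ∀ h → unread w h ≡ unread w′ h
        unread-≡ h = firstFailure-cong (reads? (input 1 w σ) h) (reads? (input 1 w′ σ) h) transfer transfer⁻

      -- For a fixed order, the unexposed accepted shifts inject into those accepted with b = 0; the
      -- exposed ones are the error. One direction suffices, as a tester must accept for b = 1 and
      -- reject for b = 0.
      coupling : ∑ shifts (λ w → accepts t (input 1 w σ)) ≤
                 ∑ shifts (λ w → accepts t (input 0 w σ)) + ∑ shifts (λ w → indicator (exposed? w))
      coupling = begin
        ∑ shifts (λ w → indicator (accepted? 1 w))
          ≤⟨ ∑-mono shifts split ⟩
        ∑ shifts (λ w → indicator (accepted? 1 w ×-dec ¬? (exposed? w)) + indicator (exposed? w))
          ≡⟨ ∑-+ shifts _ _ ⟩
        ∑ shifts (λ w → indicator (accepted? 1 w ×-dec ¬? (exposed? w))) + ∑ shifts (λ w → indicator (exposed? w))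
          ≡⟨ cong (_+ ∑ shifts (λ w → indicator (exposed? w))) (∑-indicator (λ w → accepted? 1 w ×-dec ¬? (exposed? w)) shifts) ⟩
        length (filter (λ w → accepted? 1 w ×-dec ¬? (exposed? w)) shifts) + ∑ shifts (λ w → indicator (exposed? w))
          ≤⟨ +-monoˡ-≤ _ (length-≤ (filter⁺ (λ w → accepted? 1 w ×-dec ¬? (exposed? w)) shifts-unique) couple
               (λ w∈ → ∈-filter⁺ (accepted? 0) (∈-shifts _) (trans (sym (proj₁ (couple-local (proj₂ (kept w∈))))) (proj₁ (kept w∈))))
               (λ w∈ w′∈ → couple-injective (proj₂ (kept w∈)) (proj₂ (kept w′∈)))) ⟩
        length (filter (accepted? 0) shifts) + ∑ shifts (λ w → indicator (exposed? w))
          ≡⟨ cong (_+ ∑ shifts (λ w → indicator (exposed? w))) (∑-indicator (accepted? 0) shifts) ⟨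
        ∑ shifts (λ w → indicator (accepted? 0 w)) + ∑ shifts (λ w → indicator (exposed? w)) ∎
        where
        open ≤-Reasoning
        accepted? : ∀ b → Decidable (λ w → run t (input b w σ) ≡ true)
        accepted? b w = run t (input b w σ) Bool.≟ true
        shifts-unique : Unique shifts
        shifts-unique = vectors-unique (vectors-unique (allFin⁺ k) k′) m
        ∈-shifts : ∀ w → w ∈ shifts
        ∈-shifts = ∈-vectors (∈-vectors ∈-allFin)
        kept : ∀ {w} → w ∈ filter (λ w → accepted? 1 w ×-dec ¬? (exposed? w)) shifts → run t (input 1 w σ) ≡ true × ¬ Exposed w
        kept w∈ = proj₂ (∈-filter⁻ (λ w → accepted? 1 w ×-dec ¬? (exposed? w)) {xs = shifts} w∈)
        split : ∀ w → indicator (accepted? 1 w) ≤ indicator (accepted? 1 w ×-dec ¬? (exposed? w)) + indicator (exposed? w)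
        split w with accepted? 1 w | exposed? w
        ... | no _  | _     = z≤n
        ... | yes _ | yes _ = ≤-refl
        ... | yes _ | no _  = ≤-refl

    -- Counting the exposed pairs of an order and shifts

    strategy : ∀ {q} → Shifts → DTree n q → Strategy n n q
    strategy w (leaf _)    = stop
    -- With w fixed, an answer is a function of the slot read, so the tree depends on the order
    -- alone.
    strategy w (query i f) = ask i (λ s → strategy w (f (value 1 w s)))

    collects-strategy : ∀ {q} w (t : DTree n q) σ κ →
                        (∀ x → κ x ≢ 0 → ∃ λ p → Queried t (input 1 w σ) p × lookup σ p ≡ x) → collects (strategy w t) κ σ ≡ 1
    collects-strategy w (leaf _) σ κ reached = cong (0 ^_) (trans (∑-cong (allFin n) κ≗0) (∑-zero (allFin n)))
      where
      κ≗0 : ∀ x → κ x ≡ 0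
      κ≗0 x with κ x ≟ 0
      ... | yes eq = eq
      ... | no neq with reached x neq
      ... | _ , () , _
    collects-strategy w (query i f) σ κ reached = collects-strategy w (f (value 1 w s)) σ (κ ∖ s) reached′
      where
      s = lookup σ i
      reached′ : ∀ x → (κ ∖ s) x ≢ 0 → ∃ λ p → Queried (f (value 1 w s)) (input 1 w σ) p × lookup σ p ≡ x
      reached′ x ≢0 with reached x (*≢0ˡ ≢0)
      ... | p , inj₁ refl , refl = contradiction (∖-self κ s) ≢0
      ... | p , inj₂ queried , eq = p , queried , eq

    -- One slot per coordinate of block h. The rows c may differ, since slots with different y can
    -- expose the block together.
    cells : Fin m → Vec (Fin (k ^ k′)) k → Fin k → Fin n
    cells h c i = codeOf (inj₁ (h , lookup c i , i))

    cells-injective : ∀ h c → Injective _≡_ _≡_ (cells h c)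
    cells-injective h c eq = go (codeOf-injective eq)
      where
      go : ∀ {y y′ i i′} → _≡_ {A = Slot} (inj₁ (h , y , i)) (inj₁ (h , y′ , i′)) → i ≡ i′
      go refl = refl

    mark : Fin m → Vec (Fin (k ^ k′)) k → Fin n → ℕ
    mark h c x = ∑ (allFin k) (λ i → δ (cells h c i) x)

    ∥mark∥ : ∀ h c → ∥ mark h c ∥ ≡ k
    ∥mark∥ h c = begin
      ∑ (allFin n) (λ x → ∑ (allFin k) (λ i → δ (cells h c i) x)) ≡⟨ ∑-swap (allFin n) (allFin k) _ ⟩
      ∑ (allFin k) (λ i → ∑ (allFin n) (δ (cells h c i)))        ≡⟨ ∑-cong (allFin k) (λ i → trans (∑-cong (allFin n) (λ x → sym (*-identityʳ _))) (∑-δ (cells h c i) (λ _ → 1))) ⟩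
      ∑ (allFin k) (λ _ → 1)                                      ≡⟨ ∑-const (allFin k) 1 ⟩
      length (allFin k) * 1                                       ≡⟨ trans (*-identityʳ _) (length-allFin k) ⟩
      k                                                           ∎
      where open ≡-Reasoning

    transversals : List (Vec (Fin (k ^ k′)) k)
    transversals = vectors (allFin (k ^ k′)) k

    -- Union bound: an exposed block supplies one read slot per coordinate, that is, a transversal
    -- whose cells are all collected.
    exposed≤ : ∀ {q} (t : DTree n q) σ w → indicator (exposed? t σ w) ≤
               ∑ (allFin m) (λ h → ∑ transversals (λ c → collects (strategy w t) (mark h c) σ))
    exposed≤ t σ w with exposed? t σ w
    ... | no _ = z≤n
    ... | yes (h , reads) = begin
      1 ≡⟨ collects-strategy w t σ (mark h c) reached ⟨
      collects (strategy w t) (mark h c) σ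
        ≤⟨ ∈⇒≤∑ (λ c → collects (strategy w t) (mark h c) σ) (∈-vectors ∈-allFin c) ⟩
      ∑ transversals (λ c → collects (strategy w t) (mark h c) σ)
        ≤⟨ ∈⇒≤∑ (λ h → ∑ transversals (λ c → collects (strategy w t) (mark h c) σ)) (∈-allFin h) ⟩
      ∑ (allFin m) (λ h → ∑ transversals (λ c → collects (strategy w t) (mark h c) σ)) ∎
      where
      open ≤-Reasoning
      row : Fin k → Fin (k ^ k′)
      row i = proj₁ (proj₂ (proj₂ (reads i)))
      c = tabulate row
      reached : ∀ x → mark h c x ≢ 0 → ∃ λ p → Queried t (input 1 w σ) p × lookup σ p ≡ x
      reached x ≢0 with ∑≢0⇒∃ (allFin k) _ ≢0
      ... | i , δ≢0 = proj₁ (reads i) , proj₁ (proj₂ (reads i)) , slotOf-injective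
        (trans (proj₂ (proj₂ (proj₂ (reads i))))
        (trans (cong (λ y → inj₁ (h , y , i)) (sym (lookup∘tabulate row i)))
        (trans (sym (slotOf-codeOf _)) (cong slotOf (δ≢0⇒≡ δ≢0)))))

    distinct : Vec (Fin n) n → ℕ
    distinct = distinctIn (λ _ → 1)

    arrangements : List (Vec (Fin n) n)
    arrangements = vectors (allFin n) n

    ∑-collects-mark : ∀ {q} (t : Strategy n n q) h c →
                      ∑ arrangements (λ σ → distinct σ * collects t (mark h c) σ) ≤ q ^ k * (n ∸ k) !
    ∑-collects-mark {q} t h c = begin
      ∑ arrangements (λ σ → distinct σ * collects t κ σ)
        ≡⟨ ∑-cong arrangements (λ σ → cong (_* collects t κ σ) (distinctIn-cong σ (λ x → sym (m∸n+n≡m (κ≤1 x))))) ⟩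
      ∑ arrangements (λ σ → distinctIn (λ x → b x + κ x) σ * collects t κ σ)
        ≤⟨ ∑-collects q t b κ (λ x → ≤-reflexive (m∸n+n≡m (κ≤1 x))) size ⟩
      q ^ ∥ κ ∥ * ∥ b ∥ !
        ≡⟨ cong₂ (λ u v → q ^ u * v !) (∥mark∥ h c) (trans (sym (m+n∸n≡m ∥ b ∥ ∥ κ ∥)) (cong₂ _∸_ size (∥mark∥ h c))) ⟩
      q ^ k * (n ∸ k) ! ∎
      where
      open ≤-Reasoning
      κ = mark h c
      κ≤1 : ∀ x → κ x ≤ 1
      κ≤1 = ∑-δ-injective≤1 (cells-injective h c)
      b : Fin n → ℕ
      b x = 1 ∸ κ x
      size : ∥ b ∥ + ∥ κ ∥ ≡ n
      size = trans (sym (∑-+ (allFin n) b κ)) (trans (∑-cong (allFin n) (λ x → m∸n+n≡m (κ≤1 x)))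
        (trans (∑-const (allFin n) 1) (trans (*-identityʳ _) (length-allFin n))))

    errors : ℕ → ℕ
    errors q = length shifts * (m * ((k ^ k′) ^ k * (q ^ k * (n ∸ k) !)))

    -- The sum over shifts is moved outside the sum over orders, because the strategy is determined
    -- only once w is fixed.
    ∑-exposed : ∀ {q} (t : DTree n q) →
                ∑ arrangements (λ σ → distinct σ * ∑ shifts (λ w → indicator (exposed? t σ w))) ≤ errors q
    ∑-exposed {q} t = begin
      ∑ arrangements (λ σ → distinct σ * ∑ shifts (λ w → indicator (exposed? t σ w)))
        ≤⟨ ∑-mono arrangements (λ σ → *-monoʳ-≤ (distinct σ) (∑-mono shifts (exposed≤ t σ))) ⟩
      ∑ arrangements (λ σ → distinct σ * ∑ shifts (λ w → ∑ (allFin m) (λ h → ∑ transversals (λ c → X w h c σ))))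
        ≡⟨ exchange shifts _ ⟩
      ∑ shifts (λ w → ∑ arrangements (λ σ → distinct σ * ∑ (allFin m) (λ h → ∑ transversals (λ c → X w h c σ))))
        ≡⟨ ∑-cong shifts (λ w → trans (exchange (allFin m) _) (∑-cong (allFin m) (λ h → exchange transversals _))) ⟩
      ∑ shifts (λ w → ∑ (allFin m) (λ h → ∑ transversals (λ c → ∑ arrangements (λ σ → distinct σ * X w h c σ))))
        ≤⟨ ∑-mono shifts (λ w → ∑-mono (allFin m) (λ h → ∑-mono transversals (λ c → ∑-collects-mark (strategy w t) h c))) ⟩
      ∑ shifts (λ w → ∑ (allFin m) (λ h → ∑ transversals (λ c → q ^ k * (n ∸ k) !)))
        ≡⟨ trans (∑-const shifts _) (cong (length shifts *_) (trans (∑-const (allFin m) _)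
             (cong₂ _*_ (length-allFin m) (trans (∑-const transversals _) (cong (_* (q ^ k * (n ∸ k) !))
               (trans (length-vectors (allFin (k ^ k′)) k) (cong (_^ k) (length-allFin (k ^ k′))))))))) ⟩
      errors q ∎
      where
      open ≤-Reasoning
      X : Shifts → Fin m → Vec (Fin (k ^ k′)) k → Vec (Fin n) n → ℕ
      X w h c σ = collects (strategy w t) (mark h c) σ
      exchange : ∀ {A : Set} (xs : List A) (f : Vec (Fin n) n → A → ℕ) →
                 ∑ arrangements (λ σ → distinct σ * ∑ xs (f σ)) ≡ ∑ xs (λ x → ∑ arrangements (λ σ → distinct σ * f σ x))
      exchange xs f = trans (∑-cong arrangements (λ σ → sym (∑-*ˡ xs (distinct σ) (f σ)))) (∑-swap arrangements xs _)

    -- The 0/1 weight `distinct` suits the recursive counts; a list of the permutations is what the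
    -- averages over individual inputs range over.
    injections : List (Vec (Fin n) n)
    injections = filter (λ σ → ¬? (distinct σ ≟ 0)) arrangements

    ∑-injections : ∀ f → ∑ injections f ≡ ∑ arrangements (λ σ → distinct σ * f σ)
    ∑-injections f = trans (∑-filter (λ σ → ¬? (distinct σ ≟ 0)) arrangements f)
      (∑-cong arrangements (λ σ → cong (_* f σ) (agree (distinct σ) (distinctIn≤1 _ (λ _ → ≤-refl) σ))))
      where
      agree : ∀ d → d ≤ 1 → indicator (¬? (d ≟ 0)) ≡ d
      agree 0 _ = refl
      agree 1 _ = refl
      agree (suc (suc _)) (s≤s ())

    length-injections : length injections ≡ n !
    length-injections = begin
      length injections                          ≡⟨ trans (∑-const injections 1) (*-identityʳ _) ⟨
      ∑ injections (λ _ → 1)                     ≡⟨ ∑-injections (λ _ → 1) ⟩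
      ∑ arrangements (λ σ → distinct σ * 1)      ≡⟨ ∑-cong arrangements (λ σ → *-identityʳ _) ⟩
      ∑ arrangements distinct                    ≡⟨ ∑-distinctIn n (λ _ → 1) (λ _ → ≤-refl) (trans (∑-const (allFin n) 1) (trans (*-identityʳ _) (length-allFin n))) ⟩
      n !                                        ∎
      where open ≡-Reasoning

    injections-injective : ∀ {σ} → σ ∈ injections → Injective _≡_ _≡_ (lookup σ)
    injections-injective {σ} σ∈ = distinctIn-injective _ σ (proj₂ (∈-filter⁻ (λ σ → ¬? (distinct σ ≟ 0)) {xs = arrangements} σ∈))

    Ω : List (Vec (Fin n) n × Shifts)
    Ω = cartesianProduct injections shifts

    ∑-accepts : ∀ {q} (t : DTree n q) →
                ∑ Ω (λ { (σ , w) → accepts t (input 1 w σ) }) ≤ ∑ Ω (λ { (σ , w) → accepts t (input 0 w σ) }) + errors q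
    ∑-accepts {q} t = begin
      ∑ Ω (λ { (σ , w) → accepts t (input 1 w σ) })
        ≡⟨ ∑-cartesianProductWith _,_ injections shifts _ ⟩
      ∑ injections (λ σ → ∑ shifts (λ w → accepts t (input 1 w σ)))
        ≤⟨ ∑-mono injections (coupling t) ⟩
      ∑ injections (λ σ → ∑ shifts (λ w → accepts t (input 0 w σ)) + ∑ shifts (λ w → indicator (exposed? t σ w)))
        ≡⟨ ∑-+ injections _ _ ⟩
      ∑ injections (λ σ → ∑ shifts (λ w → accepts t (input 0 w σ))) + ∑ injections (λ σ → ∑ shifts (λ w → indicator (exposed? t σ w)))
        ≤⟨ +-mono-≤ (≤-reflexive (sym (∑-cartesianProductWith _,_ injections shifts _)))
             (≤-trans (≤-reflexive (∑-injections _)) (∑-exposed t)) ⟩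
      ∑ Ω (λ { (σ , w) → accepts t (input 0 w σ) }) + errors q ∎
      where open ≤-Reasoning

  -- Numerical estimates

  N^j*[n∸j]!≤2^j*n! : ∀ N j n → N + 2 * j ≤ 2 * n → N ^ j * (n ∸ j) ! ≤ 2 ^ j * n !
  N^j*[n∸j]!≤2^j*n! N zero    n       _  = ≤-refl
  N^j*[n∸j]!≤2^j*n! N (suc j) zero    le rewrite n≤0⇒n≡0 (m+n≤o⇒m≤o N le) = z≤n
  -- Each of the top factors of the factorial is at least N / 2. N is kept apart from n because n
  -- shrinks in the induction, which preserves `N + 2 * j ≤ 2 * n`.
  N^j*[n∸j]!≤2^j*n! N (suc j) (suc n) le = begin
    N * N ^ j * (n ∸ j) !        ≡⟨ *-assoc N (N ^ j) _ ⟩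
    N * (N ^ j * (n ∸ j) !)      ≤⟨ *-mono-≤ (m+n≤o⇒m≤o N le) (N^j*[n∸j]!≤2^j*n! N j n le′) ⟩
    2 * suc n * (2 ^ j * n !)    ≡⟨ solve 3 (λ a b c → con 2 :* a :* (b :* c) := con 2 :* b :* (a :* c)) refl (suc n) (2 ^ j) (n !) ⟩
    2 * 2 ^ j * (suc n * n !)    ∎
    where
    open ≤-Reasoning
    le′ : N + 2 * j ≤ 2 * n
    le′ = +-cancelʳ-≤ 2 (N + 2 * j) (2 * n) (subst₂ _≤_
      (solve 2 (λ N j → N :+ con 2 :* (con 1 :+ j) := N :+ con 2 :* j :+ con 2) refl N j)
      (solve 1 (λ n → con 2 :* (con 1 :+ n) := con 2 :* n :+ con 2) refl n) le)

  -- One factor n of n^k pays for the union bound over m ≤ n blocks, which leaves the exponent k -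
  -- 1.
  queryBound : ∀ L m y k′ q n → L ≢ 0 → m ≤ n → 2 * suc k′ ≤ n →
               n ! * L ≤ 3 * (L * (m * (y * (q ^ suc k′ * (n ∸ suc k′) !)))) → n ^ k′ ≤ 2 ^ suc k′ * (3 * y) * q ^ suc k′
  queryBound L m y k′ q n L≢0 m≤n 2k≤n le = *-cancelˡ-≤ n {{>-nonZero 0<n}} (*-cancelʳ-≤ _ _ F {{(n ∸ k) !≢0}} (begin
    n ^ k * F                                    ≤⟨ N^j*[n∸j]!≤2^j*n! n k n (≤-trans (+-monoʳ-≤ n 2k≤n) (≤-reflexive (cong (n +_) (sym (+-identityʳ n))))) ⟩
    2 ^ k * n !                                  ≤⟨ *-monoʳ-≤ (2 ^ k) (*-cancelʳ-≤ (n !) _ L {{≢-nonZero L≢0}} (≤-trans le (≤-reflexive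
                                                      (solve 5 (λ L m y Q F → con 3 :* (L :* (m :* (y :* (Q :* F)))) := con 3 :* (m :* (y :* (Q :* F))) :* L) refl L m y (q ^ k) F)))) ⟩
    2 ^ k * (3 * (m * (y * (q ^ k * F))))        ≤⟨ *-monoʳ-≤ (2 ^ k) (*-monoʳ-≤ 3 (*-monoˡ-≤ (y * (q ^ k * F)) m≤n)) ⟩
    2 ^ k * (3 * (n * (y * (q ^ k * F))))        ≡⟨ solve 5 (λ P n y Q F → P :* (con 3 :* (n :* (y :* (Q :* F)))) := n :* (P :* (con 3 :* y) :* Q) :* F) refl (2 ^ k) n y (q ^ k) F ⟩
    n * (2 ^ k * (3 * y) * q ^ k) * F            ∎))
    where
    open ≤-Reasoning
    k = suc k′
    F = (n ∸ k) !
    0<n : 0 < n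
    0<n = ≤-trans (s≤s z≤n) 2k≤n

  -- At least one block exists, since m = 0 would give n = r < g. So the remainder is at most
  -- doubling: n < 2 * m * g, and m ≤ 2 * d.
  farBound : ∀ m g r d n → n ≡ m * g + r → r < g → g ≤ n → m ≤ d * 2 → n < suc (4 * g) * d
  farBound zero g r d n refl r<g g≤n _ = contradiction (<-≤-trans r<g g≤n) (<-irrefl refl)
  farBound (suc m) g r d n refl r<g _ m<2d = begin-strict
    suc m * g + r            <⟨ +-monoʳ-< (suc m * g) r<g ⟩
    suc m * g + g            ≤⟨ +-monoʳ-≤ (suc m * g) (m≤m+n g (m * g)) ⟩
    suc m * g + suc m * g    ≤⟨ +-mono-≤ (*-monoˡ-≤ g m<2d) (*-monoˡ-≤ g m<2d) ⟩
    d * 2 * g + d * 2 * g    ≡⟨ solve 2 (λ d g → d :* con 2 :* g :+ d :* con 2 :* g := con 4 :* g :* d) refl d g ⟩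
    4 * g * d                ≤⟨ m≤n+m (4 * g * d) d ⟩
    suc (4 * g) * d          ∎
    where open ≤-Reasoning

  slotLayout : ∀ {n} e m r → n ≡ m * (suc (suc e) ^ suc e * suc (suc e)) + r → Fin n ↔ Inputs.Slot e n m r
  slotLayout e m r refl = (((↔-refl ×-↔ *↔×) ↔-∘ *↔×) ⊎-↔ ↔-refl) ↔-∘ +↔⊎

-- Rational weights and averaging over inputs

module Averages where
  open import Data.Integer using (+_)
  open import Data.Nat using (ℕ)
  open import Data.Rational using (ℚ; 0ℚ; 1ℚ; _+_; _*_; _≤_; _<_; _/_; toℚᵘ; nonNegative)
  open import Data.Rational.Properties using (toℚᵘ-fromℚᵘ; toℚᵘ-injective; toℚᵘ-homo-+; toℚᵘ-homo-*; toℚᵘ-cancel-≤; toℚᵘ-cancel-<; toℚᵘ-mono-≤)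
  open import Data.Rational.Unnormalised as ℚᵘ using (mkℚᵘ; *≡*; *≤*; *<*)
  import Data.Rational.Unnormalised.Properties as ℚᵘ
  open Counting using (∑; accepts)

  toℚᵘ-⟦⟧ : ∀ m → toℚᵘ ⟦ m ⟧ ℚᵘ.≃ mkℚᵘ (+ m) 0
  toℚᵘ-⟦⟧ m = toℚᵘ-fromℚᵘ (mkℚᵘ (+ m) 0)

  ⟦⟧-+ : ∀ a b → ⟦ a ℕ.+ b ⟧ ≡ ⟦ a ⟧ + ⟦ b ⟧
  ⟦⟧-+ a b = toℚᵘ-injective (begin
    toℚᵘ ⟦ a ℕ.+ b ⟧                 ≈⟨ toℚᵘ-⟦⟧ (a ℕ.+ b) ⟩
    mkℚᵘ (+ (a ℕ.+ b)) 0             ≈⟨ *≡* (cong (ℤ._* + 1) (sym (cong₂ ℤ._+_ (ℤ.*-identityʳ (+ a)) (ℤ.*-identityʳ (+ b))))) ⟩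
    mkℚᵘ (+ a) 0 ℚᵘ.+ mkℚᵘ (+ b) 0   ≈⟨ ℚᵘ.+-cong (toℚᵘ-⟦⟧ a) (toℚᵘ-⟦⟧ b) ⟨
    toℚᵘ ⟦ a ⟧ ℚᵘ.+ toℚᵘ ⟦ b ⟧       ≈⟨ toℚᵘ-homo-+ ⟦ a ⟧ ⟦ b ⟧ ⟨
    toℚᵘ (⟦ a ⟧ + ⟦ b ⟧)             ∎)
    where open import Relation.Binary.Reasoning.Setoid ℚᵘ.≃-setoid

  ⟦⟧-* : ∀ a b → ⟦ a ℕ.* b ⟧ ≡ ⟦ a ⟧ * ⟦ b ⟧
  ⟦⟧-* a b = toℚᵘ-injective (begin
    toℚᵘ ⟦ a ℕ.* b ⟧                 ≈⟨ toℚᵘ-⟦⟧ (a ℕ.* b) ⟩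
    mkℚᵘ (+ (a ℕ.* b)) 0             ≈⟨ *≡* (cong (ℤ._* + 1) (ℤ.pos-* a b)) ⟩
    mkℚᵘ (+ a) 0 ℚᵘ.* mkℚᵘ (+ b) 0   ≈⟨ ℚᵘ.*-cong (toℚᵘ-⟦⟧ a) (toℚᵘ-⟦⟧ b) ⟨
    toℚᵘ ⟦ a ⟧ ℚᵘ.* toℚᵘ ⟦ b ⟧       ≈⟨ toℚᵘ-homo-* ⟦ a ⟧ ⟦ b ⟧ ⟨
    toℚᵘ (⟦ a ⟧ * ⟦ b ⟧)             ∎)
    where open import Relation.Binary.Reasoning.Setoid ℚᵘ.≃-setoid

  ⟦⟧-mono-≤ : ∀ {a b} → a ℕ.≤ b → ⟦ a ⟧ ≤ ⟦ b ⟧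
  ⟦⟧-mono-≤ {a} {b} a≤b = toℚᵘ-cancel-≤ (begin
    toℚᵘ ⟦ a ⟧   ≃⟨ toℚᵘ-⟦⟧ a ⟩
    mkℚᵘ (+ a) 0 ≤⟨ *≤* (ℤ.*-monoʳ-≤-nonNeg (+ 1) (ℤ.+≤+ a≤b)) ⟩
    mkℚᵘ (+ b) 0 ≃⟨ toℚᵘ-⟦⟧ b ⟨
    toℚᵘ ⟦ b ⟧   ∎)
    where open ℚᵘ.≤-Reasoning

  ⟦⟧-cancel-≤ : ∀ {a b} → ⟦ a ⟧ ≤ ⟦ b ⟧ → a ℕ.≤ b
  ⟦⟧-cancel-≤ {a} {b} le = go (begin
    mkℚᵘ (+ a) 0 ≃⟨ toℚᵘ-⟦⟧ a ⟨
    toℚᵘ ⟦ a ⟧   ≤⟨ toℚᵘ-mono-≤ le ⟩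
    toℚᵘ ⟦ b ⟧   ≃⟨ toℚᵘ-⟦⟧ b ⟩
    mkℚᵘ (+ b) 0 ∎)
    where
    open ℚᵘ.≤-Reasoning
    go : mkℚᵘ (+ a) 0 ℚᵘ.≤ mkℚᵘ (+ b) 0 → a ℕ.≤ b
    go (*≤* p) = ℤ.drop‿+≤+ (ℤ.*-cancelʳ-≤-pos (+ a) (+ b) (+ 1) p)

  unitFraction : ℕ → ℚ
  unitFraction C = + 1 / ℕ.suc C

  unitFraction-* : ∀ C a → toℚᵘ (unitFraction C * ⟦ a ⟧) ℚᵘ.≃ mkℚᵘ (+ a) C
  unitFraction-* C a = begin
    toℚᵘ (unitFraction C * ⟦ a ⟧)         ≈⟨ toℚᵘ-homo-* (unitFraction C) ⟦ a ⟧ ⟩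
    toℚᵘ (unitFraction C) ℚᵘ.* toℚᵘ ⟦ a ⟧ ≈⟨ ℚᵘ.*-cong (toℚᵘ-fromℚᵘ (mkℚᵘ (+ 1) C)) (toℚᵘ-⟦⟧ a) ⟩
    mkℚᵘ (+ 1) C ℚᵘ.* mkℚᵘ (+ a) 0        ≈⟨ *≡* (cong₂ ℤ._*_ (ℤ.*-identityˡ (+ a)) (cong +_ (sym (ℕ.*-identityʳ (ℕ.suc C))))) ⟩
    mkℚᵘ (+ a) C                          ∎
    where open import Relation.Binary.Reasoning.Setoid ℚᵘ.≃-setoid

  0<unitFraction : ∀ C → 0ℚ < unitFraction C
  0<unitFraction C = toℚᵘ-cancel-< (ℚᵘ.<-respʳ-≃ (ℚᵘ.≃-sym (toℚᵘ-fromℚᵘ (mkℚᵘ (+ 1) C)))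
    (*<* (subst (ℤ._< + 1 ℤ.* + 1) (sym (ℤ.*-zeroˡ (+ ℕ.suc C))) (ℤ.+<+ (ℕ.s≤s ℕ.z≤n)))))

  unitFraction-*-≤ : ∀ C {a b} → a ℕ.≤ ℕ.suc C ℕ.* b → unitFraction C * ⟦ a ⟧ ≤ ⟦ b ⟧
  unitFraction-*-≤ C {a} {b} a≤Cb = toℚᵘ-cancel-≤ (begin
    toℚᵘ (unitFraction C * ⟦ a ⟧) ≃⟨ unitFraction-* C a ⟩
    mkℚᵘ (+ a) C                  ≤⟨ *≤* (subst₂ ℤ._≤_ (sym (ℤ.*-identityʳ (+ a)))
                                       (trans (cong +_ (ℕ.*-comm (ℕ.suc C) b)) (ℤ.pos-* b (ℕ.suc C))) (ℤ.+≤+ a≤Cb)) ⟩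
    mkℚᵘ (+ b) 0                  ≃⟨ toℚᵘ-⟦⟧ b ⟨
    toℚᵘ ⟦ b ⟧                    ∎)
    where open ℚᵘ.≤-Reasoning

  unitFraction-*-< : ∀ C {a b} → a ℕ.< ℕ.suc C ℕ.* b → unitFraction C * ⟦ a ⟧ < ⟦ b ⟧
  unitFraction-*-< C {a} {b} a<Cb = toℚᵘ-cancel-< (begin-strict
    toℚᵘ (unitFraction C * ⟦ a ⟧) ≃⟨ unitFraction-* C a ⟩
    mkℚᵘ (+ a) C                  <⟨ *<* (subst₂ ℤ._<_ (sym (ℤ.*-identityʳ (+ a)))
                                       (trans (cong +_ (ℕ.*-comm (ℕ.suc C) b)) (ℤ.pos-* b (ℕ.suc C))) (ℤ.+<+ a<Cb)) ⟩
    mkℚᵘ (+ b) 0                  ≃⟨ toℚᵘ-⟦⟧ b ⟨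
    toℚᵘ ⟦ b ⟧                    ∎)
    where open ℚᵘ.≤-Reasoning

  ∑ℚ : List A → (A → ℚ) → ℚ
  ∑ℚ []       f = 0ℚ
  ∑ℚ (x ∷ xs) f = f x + ∑ℚ xs f

  ∑ℚ-mono : ∀ (xs : List A) {f g : A → ℚ} → (∀ {x} → x ∈ xs → f x ≤ g x) → ∑ℚ xs f ≤ ∑ℚ xs g
  ∑ℚ-mono []       le = ℚ.≤-refl
  ∑ℚ-mono (x ∷ xs) le = ℚ.+-mono-≤ (le (here refl)) (∑ℚ-mono xs (le ∘ there))

  ∑ℚ-const : ∀ (xs : List A) c → ∑ℚ xs (λ _ → c) ≡ ⟦ length xs ⟧ * c
  ∑ℚ-const []       c = sym (ℚ.*-zeroˡ c)
  ∑ℚ-const (x ∷ xs) c = begin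
    c + ∑ℚ xs (λ _ → c)              ≡⟨ cong₂ _+_ (sym (ℚ.*-identityˡ c)) (∑ℚ-const xs c) ⟩
    1ℚ * c + ⟦ length xs ⟧ * c       ≡⟨ ℚ.*-distribʳ-+ c 1ℚ ⟦ length xs ⟧ ⟨
    (1ℚ + ⟦ length xs ⟧) * c         ≡⟨ cong (_* c) (⟦⟧-+ 1 (length xs)) ⟨
    ⟦ ℕ.suc (length xs) ⟧ * c          ∎
    where open ≡-Reasoning

  ∑ℚ-affine : ∀ (xs : List A) w (a : A → ℕ) (b : A → ℚ) → ∑ℚ xs (λ x → w * ⟦ a x ⟧ + b x) ≡ w * ⟦ ∑ xs a ⟧ + ∑ℚ xs b
  ∑ℚ-affine []       w a b = sym (trans (ℚ.+-identityʳ _) (ℚ.*-zeroʳ w))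
  ∑ℚ-affine (x ∷ xs) w a b = begin
    w * ⟦ a x ⟧ + b x + ∑ℚ xs (λ x → w * ⟦ a x ⟧ + b x)
      ≡⟨ cong (λ z → w * ⟦ a x ⟧ + b x + z) (∑ℚ-affine xs w a b) ⟩
    w * ⟦ a x ⟧ + b x + (w * ⟦ ∑ xs a ⟧ + ∑ℚ xs b)
      ≡⟨ solve 5 (λ w p b q c → w :* p :+ b :+ (w :* q :+ c) := w :* (p :+ q) :+ (b :+ c)) refl w ⟦ a x ⟧ (b x) ⟦ ∑ xs a ⟧ (∑ℚ xs b) ⟩
    w * (⟦ a x ⟧ + ⟦ ∑ xs a ⟧) + (b x + ∑ℚ xs b)
      ≡⟨ cong (λ z → w * z + (b x + ∑ℚ xs b)) (⟦⟧-+ (a x) (∑ xs a)) ⟨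
    w * ⟦ a x ℕ.+ ∑ xs a ⟧ + (b x + ∑ℚ xs b) ∎
    where
    open ≡-Reasoning
    open ℚ.+-*-Solver using (solve; con; _:+_; _:*_; _:=_)

  acceptProb-∷ : ∀ {n q} w (t : DTree n q) ts A → acceptProb ((w , t) ∷ ts) A ≡ w * ⟦ accepts t A ⟧ + acceptProb ts A
  acceptProb-∷ w t ts A with run t A
  ... | true  = cong (_+ acceptProb ts A) (sym (ℚ.*-identityʳ w))
  ... | false = sym (trans (cong (_+ acceptProb ts A) (ℚ.*-zeroʳ w)) (ℚ.+-identityˡ _))

  ∑ℚ-cong : ∀ (xs : List A) {f g : A → ℚ} → (∀ x → f x ≡ g x) → ∑ℚ xs f ≡ ∑ℚ xs g
  ∑ℚ-cong []       eq = refl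
  ∑ℚ-cong (x ∷ xs) eq = cong₂ _+_ (eq x) (∑ℚ-cong xs eq)

  module Averaging {n q : ℕ} (Ω : List A) (f g : A → Seq n) (E : ℕ)
    (deterministic : ∀ (t : DTree n q) → ∑ Ω (accepts t ∘ f) ℕ.≤ ∑ Ω (accepts t ∘ g) ℕ.+ E) where

    ∑ℚ-acceptProb-∷ : ∀ w (t : DTree n q) ts (h : A → Seq n) →
                      ∑ℚ Ω (acceptProb ((w , t) ∷ ts) ∘ h) ≡ w * ⟦ ∑ Ω (accepts t ∘ h) ⟧ + ∑ℚ Ω (acceptProb ts ∘ h)
    ∑ℚ-acceptProb-∷ w t ts h = trans (∑ℚ-cong Ω (λ ω → acceptProb-∷ w t ts (h ω))) (∑ℚ-affine Ω w _ _)

    -- The averaging step of Yao's principle: the inequality for single trees is combined with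
    -- nonnegative weights, and the error scales with the total weight.
    randomized : ∀ (ts : List (ℚ × DTree n q)) → AllNonNeg ts →
                 ∑ℚ Ω (acceptProb ts ∘ f) ≤ ∑ℚ Ω (acceptProb ts ∘ g) + weightSum ts * ⟦ E ⟧
    randomized [] [] = ℚ.≤-reflexive (begin
      ∑ℚ Ω (λ _ → 0ℚ)                 ≡⟨ ℚ.+-identityʳ _ ⟨
      ∑ℚ Ω (λ _ → 0ℚ) + 0ℚ            ≡⟨ cong (λ z → ∑ℚ Ω (λ _ → 0ℚ) + z) (ℚ.*-zeroˡ ⟦ E ⟧) ⟨
      ∑ℚ Ω (λ _ → 0ℚ) + 0ℚ * ⟦ E ⟧    ∎)
      where open ≡-Reasoning
    randomized ((w , t) ∷ ts) (0≤w ∷ nn) = begin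
      ∑ℚ Ω (acceptProb ((w , t) ∷ ts) ∘ f)
        ≡⟨ ∑ℚ-acceptProb-∷ w t ts f ⟩
      w * ⟦ ∑ Ω (accepts t ∘ f) ⟧ + ∑ℚ Ω (acceptProb ts ∘ f)
        ≤⟨ ℚ.+-mono-≤ (ℚ.*-monoˡ-≤-nonNeg w {{nonNegative 0≤w}} (⟦⟧-mono-≤ (deterministic t))) (randomized ts nn) ⟩
      w * ⟦ ∑ Ω (accepts t ∘ g) ℕ.+ E ⟧ + (∑ℚ Ω (acceptProb ts ∘ g) + weightSum ts * ⟦ E ⟧)
        ≡⟨ cong (λ z → w * z + (∑ℚ Ω (acceptProb ts ∘ g) + weightSum ts * ⟦ E ⟧)) (⟦⟧-+ (∑ Ω (accepts t ∘ g)) E) ⟩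
      w * (⟦ ∑ Ω (accepts t ∘ g) ⟧ + ⟦ E ⟧) + (∑ℚ Ω (acceptProb ts ∘ g) + weightSum ts * ⟦ E ⟧)
        ≡⟨ solve 5 (λ w p E b v → w :* (p :+ E) :+ (b :+ v :* E) := w :* p :+ b :+ (w :+ v) :* E) refl
             w ⟦ ∑ Ω (accepts t ∘ g) ⟧ ⟦ E ⟧ (∑ℚ Ω (acceptProb ts ∘ g)) (weightSum ts) ⟩
      w * ⟦ ∑ Ω (accepts t ∘ g) ⟧ + ∑ℚ Ω (acceptProb ts ∘ g) + (w + weightSum ts) * ⟦ E ⟧
        ≡⟨ cong (_+ (w + weightSum ts) * ⟦ E ⟧) (∑ℚ-acceptProb-∷ w t ts g) ⟨
      ∑ℚ Ω (acceptProb ((w , t) ∷ ts) ∘ g) + weightSum ((w , t) ∷ ts) * ⟦ E ⟧ ∎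
      where
      open ℚ.≤-Reasoning
      open ℚ.+-*-Solver using (solve; con; _:+_; _:*_; _:=_)

    -- The average acceptance probabilities differ by at least 2/3 - 1/3, and the error E has to
    -- make up for this third of the sample space.
    length≤3*error : (T : RandAlg n q) →
                     (∀ {ω} → ω ∈ Ω → + 2 / 3 ≤ acceptProb (trees T) (f ω)) →
                     (∀ {ω} → ω ∈ Ω → acceptProb (trees T) (g ω) ≤ + 1 / 3) → length Ω ℕ.≤ 3 ℕ.* E
    length≤3*error T acc rej = ⟦⟧-cancel-≤ (begin
      L
        ≡⟨ solve 1 (λ L → L := con ⟦ 3 ⟧ :* (L :* con (+ 2 / 3)) :+ con (ℚ.- 1ℚ) :* L) refl L ⟩
      ⟦ 3 ⟧ * (L * (+ 2 / 3)) + ℚ.- 1ℚ * L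
        ≤⟨ ℚ.+-monoˡ-≤ (ℚ.- 1ℚ * L) (ℚ.*-monoˡ-≤-nonNeg ⟦ 3 ⟧ average) ⟩
      ⟦ 3 ⟧ * (L * (+ 1 / 3) + ⟦ E ⟧) + ℚ.- 1ℚ * L
        ≡⟨ solve 2 (λ L E → con ⟦ 3 ⟧ :* (L :* con (+ 1 / 3) :+ E) :+ con (ℚ.- 1ℚ) :* L := con ⟦ 3 ⟧ :* E) refl L ⟦ E ⟧ ⟩
      ⟦ 3 ⟧ * ⟦ E ⟧
        ≡⟨ ⟦⟧-* 3 E ⟨
      ⟦ 3 ℕ.* E ⟧ ∎)
      where
      open ℚ.≤-Reasoning
      open ℚ.+-*-Solver using (solve; con; _:+_; _:*_; _:=_)
      L = ⟦ length Ω ⟧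
      average : L * (+ 2 / 3) ≤ L * (+ 1 / 3) + ⟦ E ⟧
      average = begin
        L * (+ 2 / 3)                                                      ≡⟨ ∑ℚ-const Ω (+ 2 / 3) ⟨
        ∑ℚ Ω (λ _ → + 2 / 3)                                               ≤⟨ ∑ℚ-mono Ω acc ⟩
        ∑ℚ Ω (acceptProb (trees T) ∘ f)                                    ≤⟨ randomized (trees T) (nonneg T) ⟩
        ∑ℚ Ω (acceptProb (trees T) ∘ g) + weightSum (trees T) * ⟦ E ⟧      ≡⟨ cong (λ v → ∑ℚ Ω (acceptProb (trees T) ∘ g) + v * ⟦ E ⟧) (total T) ⟩
        ∑ℚ Ω (acceptProb (trees T) ∘ g) + 1ℚ * ⟦ E ⟧                       ≤⟨ ℚ.+-mono-≤ (∑ℚ-mono Ω rej) (ℚ.≤-reflexive (ℚ.*-identityˡ ⟦ E ⟧)) ⟩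
        ∑ℚ Ω (λ _ → + 1 / 3) + ⟦ E ⟧                                       ≡⟨ cong (_+ ⟦ E ⟧) (∑ℚ-const Ω (+ 1 / 3)) ⟩
        L * (+ 1 / 3) + ⟦ E ⟧                                              ∎

-- Constants and assembly

open Counting
open Averages

open import Data.Nat using (ℕ; _≥_; _∸_; _^_)
open import Data.Rational using (ℚ; 0ℚ; _<_; _≤_; _*_)
open import Data.Product using (Σ; _×_)

theorem3 : (k : ℕ) → k ≥ 2 →
    Σ ℚ λ ε → (0ℚ < ε) ×
    Σ ℚ λ c → (0ℚ < c) × Σ ℕ λ n₀ →
    ∀ (n q : ℕ) → n ≥ n₀ → (T : RandAlg n q) → IsTester k ε T →
    c * ⟦ n ^ (k ∸ 1) ⟧ ≤ ⟦ q ^ k ⟧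
theorem3 (ℕ.suc (ℕ.suc e)) (ℕ.s≤s (ℕ.s≤s ℕ.z≤n)) =
  -- A block has g slots and one heavy value, and a changed entry affects at most two heavy values.
  -- So at least m / 2 changes are needed, while n < 2 * m * g.
  unitFraction (4 ℕ.* g) , 0<unitFraction (4 ℕ.* g) ,
  unitFraction γ , 0<unitFraction γ ,
  -- n ≥ g provides a block, and n ≥ 2 * k makes each of the top k factors of n! at least n / 2.
  g ℕ.+ 2 ℕ.* k , bound
  where
  open Gadget e using (k′; k)
  g γ : ℕ
  g = k ^ k′ ℕ.* k
  -- `2 ^ k` compares n^k with n! / (n - k)!, 3 is the inverse of the gap between 2/3 and 1/3, and
  -- the last factor counts the transversals of a block.
  γ = 2 ^ k ℕ.* (3 ℕ.* (k ^ k′) ^ k)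
  instance
    g≢0 : ℕ.NonZero g
    g≢0 = ℕ.m*n≢0 (k ^ k′) k {{ℕ.m^n≢0 k k′}}
  bound : ∀ (n q : ℕ) → n ≥ g ℕ.+ 2 ℕ.* k → (T : RandAlg n q) → IsTester k (unitFraction (4 ℕ.* g)) T →
          unitFraction γ * ⟦ n ^ k′ ⟧ ≤ ⟦ q ^ k ⟧
  bound n q n≥n₀ T tester = unitFraction-*-≤ γ {n ^ k′} {q ^ k} (ℕ.≤-trans
    (queryBound (length shifts) m ((k ^ k′) ^ k) k′ q n shifts≢0 (ℕ.m/n≤m n g) (ℕ.m+n≤o⇒n≤o g n≥n₀)
      (subst (ℕ._≤ 3 ℕ.* errors q) length-Ω (length≤3*error T
        (λ {ω} ω∈ → proj₁ (tester _ (promise 1 ω∈)) (input₁-kfree (proj₂ ω) (proj₁ ω) (injective ω∈)))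
        (λ ω∈ → proj₂ (tester _ (promise 0 ω∈)) (far ω∈)))))
    (ℕ.m≤n+m _ (q ^ k)))
    where
    m r : ℕ
    m = n ℕ./ g
    r = n ℕ.% g
    n≡ : n ≡ m ℕ.* g ℕ.+ r
    n≡ = trans (ℕ.m≡m%n+[m/n]*n n g) (ℕ.+-comm r (m ℕ.* g))
    layout = slotLayout e m r n≡
    open Inputs e n m r using (module Layout)
    open Layout layout
    open Coupling e n m r layout
    open Averaging {q = q} Ω (λ ω → input 1 (proj₂ ω) (proj₁ ω)) (λ ω → input 0 (proj₂ ω) (proj₁ ω)) (errors q) ∑-accepts
    injective : ∀ {ω} → ω ∈ Ω → Injective _≡_ _≡_ (lookup (proj₁ ω))
    injective ω∈ = injections-injective (proj₁ (∈-cartesianProduct⁻ injections shifts ω∈))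
    promise : ∀ b {ω} → ω ∈ Ω → Promise k (input b (proj₂ ω) (proj₁ ω))
    promise b {σ , w} ω∈ = input-promise w σ (injective ω∈) b
    far : ∀ {ω} → ω ∈ Ω → Far k (unitFraction (4 ℕ.* g)) (input 0 (proj₂ ω) (proj₁ ω))
    far {σ , w} ω∈ B B-free = unitFraction-*-< (4 ℕ.* g) {n} {d}
      (farBound m g r d n n≡ (ℕ.m%n<n n g) (ℕ.m+n≤o⇒m≤o g n≥n₀) (input₀-far w σ (injective ω∈) B B-free))
      where d = dist (input 0 w σ) B
    length-Ω : length Ω ≡ n ℕ.! ℕ.* length shifts
    length-Ω = trans (length-cartesianProductWith _,_ injections shifts) (cong (ℕ._* length shifts) length-injections)
    shifts≢0 : length shifts ≢ 0
    shifts≢0 eq = ℕ.≢-nonZero⁻¹ ((k ^ k′) ^ m) {{ℕ.m^n≢0 (k ^ k′) m {{ℕ.m^n≢0 k k′}}}} (trans (sym length-shifts) eq)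
      where
      length-shifts : length shifts ≡ (k ^ k′) ^ m
      length-shifts = trans (length-vectors (vectors (allFin k) k′) m)
        (cong (_^ m) (trans (length-vectors (allFin k) k′) (cong (_^ k′) (length-allFin k))))
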